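{- For any convex polygon $P$ and any $k\ge 2$, $k_{\mathrm{DIR}}\text{ -CONV}\not\subseteq P_{hom}$.
   Context: All graphs are finite. A polygon is a closed convex polygon in $\mathbb{R}^2$. For a finite collection of sets, its intersection graph has one vertex for each member of the collection, and two distinct vertices are adjacent iff the corresponding sets have nonempty intersection. $P_{hom}$ is the class of intersection graphs of finite collections of sets homothetic to $P$, i.e. sets obtained from $P$ by (positive) scaling and/or translation. For a set $L$ of $k$ distinct lines through the origin in $\mathbb{R}^2$, $\mathcal{P}(L)$ is the family of all polygons each of whose sides is parallel to some line of $L$; $k_{\mathrm{DIR}(L)}\text{ -CONV}$ is the class of intersection graphs of finite collections of polygons from $\mathcal{P}(L)$, and $k_{\mathrm{DIR}}\text{ -CONV}$ is the union of $k_{\mathrm{DIR}(L)}\text{ -CONV}$ over all sets $L$ of $k$ distinct lines through the origin. -}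

module Defs where

open import Data.Fin using (Fin; toℕ)
open import Data.Nat using (ℕ; suc; _⊔_)
import Data.Nat as ℕ
open import Data.Nat.DivMod using (_mod_)
import Data.Nat.Properties as ℕₚ
open import Data.Product using (_×_; _,_; ∃; ∃-syntax)
open import Data.Rational as ℚ using (ℚ; 0ℚ; 1ℚ; ½; ∣_∣)
import Data.Rational.Properties as ℚₚ
open import Data.Rational.Solver using (module +-*-Solver)
open import Data.Vec.Functional using (Vector; foldr)
open import Function.Bundles using (_⇔_)
open import Function.Definitions using (Injective)
open import Level using (0ℓ)
open import Relation.Binary.Core using (Rel)
open import Relation.Binary.Definitions using (Irreflexive; Symmetric)
open import Relation.Binary.PropositionalEquality
  using (_≡_; _≢_; refl; sym; cong; subst)
open import Relation.Nullary using (¬_)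
open import Relation.Unary using (Pred; _∈_; _≬_)

-- Real numbers are Cauchy sequences of rationals, considered up to _≈_.

Cauchy : (ℕ → ℚ) → Set
Cauchy x = ∀ ε → 0ℚ ℚ.< ε →
  ∃[ N ] (∀ m n → N ℕ.≤ m → N ℕ.≤ n → ∣ x m ℚ.- x n ∣ ℚ.< ε)

record ℝ : Set where
  constructor mkℝ
  field
    seq    : ℕ → ℚ
    cauchy : Cauchy seq

open ℝ public

infix  4 _≈_ _<_ _≤_
infixl 6 _+_ _-_
infixl 7 _*_
infix  8 -_

record _≈_ (x y : ℝ) : Set where
  constructor mk≈
  field
    close : ∀ ε → 0ℚ ℚ.< ε →
      ∃[ N ] (∀ n → N ℕ.≤ n → ∣ seq x n ℚ.- seq y n ∣ ℚ.< ε)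

record _<_ (x y : ℝ) : Set where
  constructor mk<
  field
    gap       : ℚ
    gap>0     : 0ℚ ℚ.< gap
    from      : ℕ
    separated : ∀ n → from ℕ.≤ n → seq x n ℚ.+ gap ℚ.≤ seq y n

_≤_ : Rel ℝ 0ℓ
x ≤ y = ¬ (y < x)

fromℚ : ℚ → ℝ
fromℚ q = mkℝ (λ _ → q) λ ε 0<ε →
  0 , λ _ _ _ _ → subst (λ r → ∣ r ∣ ℚ.< ε) (sym (ℚₚ.+-inverseʳ q)) 0<ε

0ℝ 1ℝ : ℝ
0ℝ = fromℚ 0ℚ
1ℝ = fromℚ 1ℚ

open +-*-Solver using (solve; _:+_; _:*_; _:-_; :-_; _:=_; con)

half : ∀ {ε} → 0ℚ ℚ.< ε → 0ℚ ℚ.< ½ ℚ.* ε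
half {ε} 0<ε = ℚₚ.positive⁻¹ (½ ℚ.* ε) {{ℚₚ.pos*pos⇒pos ½ ε {{ℚ.positive 0<ε}}}}

halves : ∀ ε → ½ ℚ.* ε ℚ.+ ½ ℚ.* ε ≡ ε
halves = solve 1 (λ e → con ½ :* e :+ con ½ :* e := e) refl

+-cauchy : ∀ x y → Cauchy x → Cauchy y → Cauchy (λ n → x n ℚ.+ y n)
+-cauchy x y cx cy ε 0<ε with cx _ (half 0<ε) | cy _ (half 0<ε)
... | M , hx | N , hy = M ⊔ N , λ m n p q → begin-strict
  ∣ (x m ℚ.+ y m) ℚ.- (x n ℚ.+ y n) ∣
    ≡⟨ cong ∣_∣ (regroup (x m) (y m) (x n) (y n)) ⟩
  ∣ (x m ℚ.- x n) ℚ.+ (y m ℚ.- y n) ∣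
    ≤⟨ ℚₚ.∣p+q∣≤∣p∣+∣q∣ (x m ℚ.- x n) (y m ℚ.- y n) ⟩
  ∣ x m ℚ.- x n ∣ ℚ.+ ∣ y m ℚ.- y n ∣
    <⟨ ℚₚ.+-mono-<
         (hx m n (ℕₚ.m⊔n≤o⇒m≤o M N p) (ℕₚ.m⊔n≤o⇒m≤o M N q))
         (hy m n (ℕₚ.m⊔n≤o⇒n≤o M N p) (ℕₚ.m⊔n≤o⇒n≤o M N q)) ⟩
  ½ ℚ.* ε ℚ.+ ½ ℚ.* ε
    ≡⟨ halves ε ⟩
  ε ∎
  where
  open ℚₚ.≤-Reasoning
  regroup : ∀ a b c d → (a ℚ.+ b) ℚ.- (c ℚ.+ d) ≡ (a ℚ.- c) ℚ.+ (b ℚ.- d)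
  regroup = solve 4 (λ a b c d →
    (a :+ b) :- (c :+ d) := (a :- c) :+ (b :- d)) refl

neg-cauchy : ∀ x → Cauchy x → Cauchy (λ n → ℚ.- x n)
neg-cauchy x cx ε 0<ε with cx ε 0<ε
... | N , h = N , λ m n p q → begin-strict
  ∣ ℚ.- x m ℚ.- ℚ.- x n ∣  ≡⟨ cong ∣_∣ (regroup (x m) (x n)) ⟩
  ∣ ℚ.- (x m ℚ.- x n) ∣    ≡⟨ ℚₚ.∣-p∣≡∣p∣ (x m ℚ.- x n) ⟩
  ∣ x m ℚ.- x n ∣          <⟨ h m n p q ⟩
  ε ∎
  where
  open ℚₚ.≤-Reasoning
  regroup : ∀ a b → ℚ.- a ℚ.- ℚ.- b ≡ ℚ.- (a ℚ.- b)
  regroup = solve 2 (λ a b → (:- a) :- (:- b) := :- (a :- b)) refl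

0<1 : 0ℚ ℚ.< 1ℚ
0<1 = ℚₚ.positive⁻¹ 1ℚ

eventually-bounded : ∀ x → Cauchy x →
  ∃[ B ] 0ℚ ℚ.< B × (∃[ N ] (∀ n → N ℕ.≤ n → ∣ x n ∣ ℚ.< B))
eventually-bounded x cx with cx 1ℚ 0<1
... | N , h = 1ℚ ℚ.+ ∣ x N ∣ , ℚₚ.+-mono-<-≤ 0<1 (ℚₚ.0≤∣p∣ (x N)) , N ,
  λ n p → begin-strict
    ∣ x n ∣                        ≡⟨ cong ∣_∣ (regroup (x n) (x N)) ⟩
    ∣ (x n ℚ.- x N) ℚ.+ x N ∣      ≤⟨ ℚₚ.∣p+q∣≤∣p∣+∣q∣ (x n ℚ.- x N) (x N) ⟩
    ∣ x n ℚ.- x N ∣ ℚ.+ ∣ x N ∣    <⟨ ℚₚ.+-monoˡ-< ∣ x N ∣ (h n N p ℕₚ.≤-refl) ⟩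
    1ℚ ℚ.+ ∣ x N ∣ ∎
  where
  open ℚₚ.≤-Reasoning
  regroup : ∀ a b → a ≡ (a ℚ.- b) ℚ.+ b
  regroup = solve 2 (λ a b → a := (a :- b) :+ b) refl

quotient : ∀ {ε D} → 0ℚ ℚ.< ε → 0ℚ ℚ.< D → ∃[ δ ] 0ℚ ℚ.< δ × D ℚ.* δ ≡ ε
quotient {ε} {D} 0<ε 0<D = D⁻¹ ℚ.* ε ,
  ℚₚ.positive⁻¹ (D⁻¹ ℚ.* ε)
    {{ℚₚ.pos*pos⇒pos D⁻¹ {{ℚₚ.1/pos⇒pos D {{D>0}}}} ε {{ℚ.positive 0<ε}}}} ,
  (begin-equality
    D ℚ.* (D⁻¹ ℚ.* ε)  ≡⟨ ℚₚ.*-assoc D D⁻¹ ε ⟨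
    D ℚ.* D⁻¹ ℚ.* ε    ≡⟨ cong (ℚ._* ε) (ℚₚ.*-inverseʳ D {{D≢0}}) ⟩
    1ℚ ℚ.* ε           ≡⟨ ℚₚ.*-identityˡ ε ⟩
    ε ∎)
  where
  open ℚₚ.≤-Reasoning
  D>0 : ℚ.Positive D
  D>0 = ℚ.positive 0<D
  D≢0 : ℚ.NonZero D
  D≢0 = ℚₚ.pos⇒nonZero D {{D>0}}
  D⁻¹ : ℚ
  D⁻¹ = ℚ.1/_ D {{D≢0}}

product-bound : ∀ {b δ} u v → 0ℚ ℚ.< δ →
  ∣ u ∣ ℚ.< b → ∣ v ∣ ℚ.< δ → ∣ u ℚ.* v ∣ ℚ.< b ℚ.* δ
product-bound {b} {δ} u v 0<δ u<b v<δ = begin-strict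
  ∣ u ℚ.* v ∣      ≡⟨ ℚₚ.∣p*q∣≡∣p∣*∣q∣ u v ⟩
  ∣ u ∣ ℚ.* ∣ v ∣  ≤⟨ ℚₚ.*-monoˡ-≤-nonNeg ∣ u ∣ {{ℚₚ.∣-∣-nonNeg u}} (ℚₚ.<⇒≤ v<δ) ⟩
  ∣ u ∣ ℚ.* δ      <⟨ ℚₚ.*-monoˡ-<-pos δ {{ℚ.positive 0<δ}} u<b ⟩
  b ℚ.* δ ∎
  where open ℚₚ.≤-Reasoning

*-cauchy : ∀ x y → Cauchy x → Cauchy y → Cauchy (λ n → x n ℚ.* y n)
*-cauchy x y cx cy ε 0<ε =
  let B , 0<B , N₁ , hB = eventually-bounded x cx
      C , 0<C , N₂ , hC = eventually-bounded y cy
      δ , 0<δ , D*δ≡ε   = quotient {ε} {B ℚ.+ C} 0<ε (ℚₚ.+-mono-< 0<B 0<C)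
      N₃ , hx           = cx δ 0<δ
      N₄ , hy           = cy δ 0<δ
  in (N₁ ⊔ N₂) ⊔ (N₃ ⊔ N₄) , λ m n p q →
  let N₁≤m = ℕₚ.m⊔n≤o⇒m≤o N₁ N₂ (ℕₚ.m⊔n≤o⇒m≤o (N₁ ⊔ N₂) (N₃ ⊔ N₄) p)
      N₂≤n = ℕₚ.m⊔n≤o⇒n≤o N₁ N₂ (ℕₚ.m⊔n≤o⇒m≤o (N₁ ⊔ N₂) (N₃ ⊔ N₄) q)
      N₃₄≤m = ℕₚ.m⊔n≤o⇒n≤o (N₁ ⊔ N₂) (N₃ ⊔ N₄) p
      N₃₄≤n = ℕₚ.m⊔n≤o⇒n≤o (N₁ ⊔ N₂) (N₃ ⊔ N₄) q
      Δx<δ = hx m n (ℕₚ.m⊔n≤o⇒m≤o N₃ N₄ N₃₄≤m) (ℕₚ.m⊔n≤o⇒m≤o N₃ N₄ N₃₄≤n)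
      Δy<δ = hy m n (ℕₚ.m⊔n≤o⇒n≤o N₃ N₄ N₃₄≤m) (ℕₚ.m⊔n≤o⇒n≤o N₃ N₄ N₃₄≤n)
  in begin-strict
  ∣ x m ℚ.* y m ℚ.- x n ℚ.* y n ∣
    ≡⟨ cong ∣_∣ (regroup (x m) (y m) (x n) (y n)) ⟩
  ∣ x m ℚ.* (y m ℚ.- y n) ℚ.+ y n ℚ.* (x m ℚ.- x n) ∣
    ≤⟨ ℚₚ.∣p+q∣≤∣p∣+∣q∣ (x m ℚ.* (y m ℚ.- y n)) (y n ℚ.* (x m ℚ.- x n)) ⟩
  ∣ x m ℚ.* (y m ℚ.- y n) ∣ ℚ.+ ∣ y n ℚ.* (x m ℚ.- x n) ∣
    <⟨ ℚₚ.+-mono-<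
         (product-bound (x m) (y m ℚ.- y n) 0<δ (hB m N₁≤m) Δy<δ)
         (product-bound (y n) (x m ℚ.- x n) 0<δ (hC n N₂≤n) Δx<δ) ⟩
  B ℚ.* δ ℚ.+ C ℚ.* δ
    ≡⟨ ℚₚ.*-distribʳ-+ δ B C ⟨
  (B ℚ.+ C) ℚ.* δ
    ≡⟨ D*δ≡ε ⟩
  ε ∎
  where
  open ℚₚ.≤-Reasoning
  regroup : ∀ a b c d →
    a ℚ.* b ℚ.- c ℚ.* d ≡ a ℚ.* (b ℚ.- d) ℚ.+ d ℚ.* (a ℚ.- c)
  regroup = solve 4 (λ a b c d →
    a :* b :- c :* d := a :* (b :- d) :+ d :* (a :- c)) refl

-- Opaque because unfolding ℚ._+_ and ℚ._*_ at open terms is very costly.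
opaque
  _+_ : ℝ → ℝ → ℝ
  x + y = mkℝ (λ n → seq x n ℚ.+ seq y n) (+-cauchy (seq x) (seq y) (cauchy x) (cauchy y))

  -_ : ℝ → ℝ
  - x = mkℝ (λ n → ℚ.- seq x n) (neg-cauchy (seq x) (cauchy x))

  _*_ : ℝ → ℝ → ℝ
  x * y = mkℝ (λ n → seq x n ℚ.* seq y n) (*-cauchy (seq x) (seq y) (cauchy x) (cauchy y))

_-_ : ℝ → ℝ → ℝ
x - y = x + - y

sum : ∀ {n} → Vector ℝ n → ℝ
sum = foldr _+_ 0ℝ

ℝ² : Set
ℝ² = ℝ × ℝ

infix  4 _≈²_ _∥_
infixl 6 _+²_ _-²_
infixl 7 _·_

_≈²_ : Rel ℝ² 0ℓ
(a , b) ≈² (c , d) = a ≈ c × b ≈ d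

0² : ℝ²
0² = 0ℝ , 0ℝ

_+²_ _-²_ : ℝ² → ℝ² → ℝ²
(a , b) +² (c , d) = a + c , b + d
(a , b) -² (c , d) = a - c , b - d

_·_ : ℝ → ℝ² → ℝ²
s · (a , b) = s * a , s * b

sum² : ∀ {n} → Vector ℝ² n → ℝ²
sum² = foldr _+²_ 0²

cross : ℝ² → ℝ² → ℝ
cross (a , b) (c , d) = a * d - b * c

_∥_ : Rel ℝ² 0ℓ
u ∥ w = cross u w ≈ 0ℝ

-- Positive iff a , b , c is a counterclockwise (nondegenerate) triangle.
orient : ℝ² → ℝ² → ℝ² → ℝ
orient a b c = cross (b -² a) (c -² a)

convexHull : ∀ {n} → Vector ℝ² n → Pred ℝ² 0ℓ
convexHull v x = ∃[ c ] (∀ i → 0ℝ ≤ c i) × sum c ≈ 1ℝ ×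
  x ≈² sum² (λ i → c i · v i)

next : ∀ {n} → Fin (suc n) → Fin (suc n)
next {n} i = suc (toℕ i) mod suc n

-- A convex polygon is given by its corners, at least three of them, listed
-- counterclockwise: each corner lies strictly to the left of every side
-- that it is not an end of.
record Polygon : Set where
  field
    size-3 : ℕ
    vertex : Vector ℝ² (3 ℕ.+ size-3)
    convex : ∀ i j → j ≢ i → j ≢ next i →
             0ℝ < orient (vertex i) (vertex (next i)) (vertex j)

  Side : Set
  Side = Fin (3 ℕ.+ size-3)

  sideVector : Side → ℝ²
  sideVector i = vertex (next i) -² vertex i

  region : Pred ℝ² 0ℓ
  region = convexHull vertex

open Polygon public using (Side; sideVector; region)

record Homothety : Set where
  field
    ratio       : ℝ
    ratio>0     : 0ℝ < ratio
    translation : ℝ²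

  image : Pred ℝ² 0ℓ → Pred ℝ² 0ℓ
  image S x = ∃[ p ] p ∈ S × x ≈² ratio · p +² translation

open Homothety public using (image)

-- A line through the origin, given by a direction vector; two such lines
-- are equal when their direction vectors are parallel.
record Line : Set where
  field
    direction : ℝ²
    nonzero   : ¬ (direction ≈² 0²)

open Line public using (direction)

_≈ˡ_ : Rel Line 0ℓ
ℓ ≈ˡ m = direction ℓ ∥ direction m

record LineSet (k : ℕ) : Set where
  field
    line     : Fin k → Line
    distinct : Injective _≡_ _≈ˡ_ line

open LineSet public using (line)

𝒫 : ∀ {k} → LineSet k → Pred Polygon 0ℓ
𝒫 L Q = ∀ (s : Side Q) → ∃[ i ] sideVector Q s ∥ direction (line L i)

record Graph : Set₁ where
  field
    order       : ℕ
    Adj         : Rel (Fin order) 0ℓ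
    symmetric   : Symmetric Adj
    irreflexive : Irreflexive _≡_ Adj

open Graph public using (order; Adj)

-- A finite collection is a family indexed by the vertices; a repeated member
-- gives distinct adjacent vertices.
IsIntersectionGraph : (G : Graph) → Vector (Pred ℝ² 0ℓ) (order G) → Set
IsIntersectionGraph G S = ∀ i j → i ≢ j → Adj G i j ⇔ (S i ≬ S j)

_hom : Polygon → Pred Graph 0ℓ
(P hom) G = ∃ λ (H : Vector Homothety (order G)) →
  IsIntersectionGraph G (λ i → image (H i) (region P))

DIR⟨_⟩-CONV : ∀ {k} → LineSet k → Pred Graph 0ℓ
DIR⟨ L ⟩-CONV G = ∃ λ (Q : Vector Polygon (order G)) → (∀ i → Q i ∈ 𝒫 L) ×
  IsIntersectionGraph G (λ i → region (Q i))

_DIR-CONV : ℕ → Pred Graph 0ℓ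
(k DIR-CONV) G = ∃ λ (L : LineSet k) → G ∈ DIR⟨ L ⟩-CONV

{-# OPTIONS --safe #-}

-- The graph is K_{N,N}, drawn as N horizontal and N vertical thin strips that cross.
-- Suppose that it is the intersection graph of homothets of P, a polygon with m corners.
-- Let A be a smallest homothet and let B_1, ..., B_N be those on the other side. Each B_j
-- contains a translate of A that meets A. If A ∩ B_j is witnessed by convex combinations of
-- the corners with weights c_j (in A) and d_j (in B_j), then the pigeonhole principle gives
-- j ≠ k for which c_j - d_j and c_k - d_k differ by at most 1/m in every entry. The uniform
-- weights 1/m therefore stay nonnegative when shifted by (c_j - d_j) - (c_k - d_k), which
-- makes the translates inside B_j and B_k meet: a contradiction. The goal is a negation, so
-- classical reasoning on the order of ℝ is available under double negations.

module Submission where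

open import Defs
open import Algebra.Bundles using (CommutativeRing)
import Algebra.Solver.Ring as RingSolver
open import Algebra.Solver.Ring.AlmostCommutativeRing
  using (Induced-equivalence; _-Raw-AlmostCommutative⟶_; fromCommutativeRing)
open import Data.Fin using (Fin; combine; finToFun; funToFin; remQuot; suc; toℕ; zero)
import Data.Fin.Properties as Finₚ
import Data.Maybe as Maybe
open import Data.Nat as ℕ using (ℕ; _^_; s≤s; suc; z≤n; zero)
import Data.Nat.Properties as ℕₚ
open import Data.Product using (_×_; _,_; ∃; ∃-syntax; ∃₂; proj₁; proj₂)
open import Data.Rational as ℚ using (ℚ; 0ℚ; 1ℚ; ½)
import Data.Rational.Properties as ℚₚ
open import Data.Rational.Solver using (module +-*-Solver)
open import Data.Sum using (inj₁; inj₂)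
open import Data.Vec.Functional using (Vector)
open import Effect.Monad using (RawMonad)
open import Function using (Equivalence; _∘_; mk⇔)
open import Level using (0ℓ)
open import Relation.Binary.Bundles using (Setoid)
open import Relation.Binary.Definitions using (WeaklyDecidable; tri<; tri≈; tri>)
open import Relation.Binary.PropositionalEquality
  using (_≡_; _≢_; cong; cong₂; refl; subst; subst₂; sym; trans)
open import Relation.Binary.Structures using (IsEquivalence)
open import Relation.Nullary using (¬_; contradiction; no; yes)
open import Relation.Nullary.Decidable using (dec⇒maybe; from-yes; ¬¬-excluded-middle)
open import Relation.Nullary.Negation using (¬¬-Monad)
open import Relation.Unary using (Pred; _∈_; _⊈_; _≬_)

private
  variable
    x y z x′ y′ η : ℝ
    n : ℕ

-- The field of real numbers

∣-∣-small⇒< : ∀ p {ε} → ℚ.∣ p ∣ ℚ.< ε → p ℚ.< ε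
∣-∣-small⇒< p {ε} ∣p∣<ε with ℚₚ.≤-total 0ℚ p
... | inj₁ 0≤p = subst (ℚ._< ε) (ℚₚ.0≤p⇒∣p∣≡p 0≤p) ∣p∣<ε
... | inj₂ p≤0 = ℚₚ.≤-<-trans p≤0 (ℚₚ.≤-<-trans (ℚₚ.0≤∣p∣ p) ∣p∣<ε)

∣p-q∣≡∣q-p∣ : ∀ p q → ℚ.∣ p ℚ.- q ∣ ≡ ℚ.∣ q ℚ.- p ∣
∣p-q∣≡∣q-p∣ p q = trans (sym (ℚₚ.∣-p∣≡∣p∣ (p ℚ.- q))) (cong ℚ.∣_∣ (swap p q))
  where
  open +-*-Solver
  swap : ∀ p q → ℚ.- (p ℚ.- q) ≡ q ℚ.- p
  swap = solve 2 (λ p q → :- (p :- q) := q :- p) refl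

∣p-q∣<ε⇒p<q+ε : ∀ p q {ε} → ℚ.∣ p ℚ.- q ∣ ℚ.< ε → p ℚ.< q ℚ.+ ε
∣p-q∣<ε⇒p<q+ε p q {ε} h =
  subst (ℚ._< q ℚ.+ ε) (cancel p q) (ℚₚ.+-monoʳ-< q (∣-∣-small⇒< (p ℚ.- q) h))
  where
  open +-*-Solver
  cancel : ∀ p q → q ℚ.+ (p ℚ.- q) ≡ p
  cancel = solve 2 (λ p q → q :+ (p :- q) := p) refl

triangle : ∀ {ε} p q r → ℚ.∣ p ℚ.- q ∣ ℚ.< ½ ℚ.* ε → ℚ.∣ q ℚ.- r ∣ ℚ.< ½ ℚ.* ε →
           ℚ.∣ p ℚ.- r ∣ ℚ.< ε
triangle {ε} p q r h₁ h₂ = begin-strict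
  ℚ.∣ p ℚ.- r ∣                        ≡⟨ cong ℚ.∣_∣ (split p q r) ⟩
  ℚ.∣ (p ℚ.- q) ℚ.+ (q ℚ.- r) ∣        ≤⟨ ℚₚ.∣p+q∣≤∣p∣+∣q∣ (p ℚ.- q) (q ℚ.- r) ⟩
  ℚ.∣ p ℚ.- q ∣ ℚ.+ ℚ.∣ q ℚ.- r ∣      <⟨ ℚₚ.+-mono-< h₁ h₂ ⟩
  ½ ℚ.* ε ℚ.+ ½ ℚ.* ε                  ≡⟨ halves ε ⟩
  ε                                    ∎
  where
  open ℚₚ.≤-Reasoning
  open +-*-Solver
  split : ∀ p q r → p ℚ.- r ≡ (p ℚ.- q) ℚ.+ (q ℚ.- r)
  split = solve 3 (λ p q r → p :- r := (p :- q) :+ (q :- r)) refl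

pointwise⇒≈ : (∀ n → seq x n ≡ seq y n) → x ≈ y
pointwise⇒≈ {x} {y} eq = mk≈ λ ε 0<ε → 0 , λ n _ →
  subst (λ p → ℚ.∣ p ℚ.- seq y n ∣ ℚ.< ε) (sym (eq n))
    (subst (λ p → ℚ.∣ p ∣ ℚ.< ε) (sym (ℚₚ.+-inverseʳ (seq y n))) 0<ε)

≈-refl : x ≈ x
≈-refl = pointwise⇒≈ λ _ → refl

≈-sym : x ≈ y → y ≈ x
≈-sym {x} {y} (mk≈ h) = mk≈ λ ε 0<ε → let N , close = h ε 0<ε in
  N , λ n N≤n → subst (ℚ._< ε) (∣p-q∣≡∣q-p∣ (seq x n) (seq y n)) (close n N≤n)

≈-trans : x ≈ y → y ≈ z → x ≈ z
≈-trans {x} {y} {z} (mk≈ h) (mk≈ h′) = mk≈ λ ε 0<ε →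
  let M , close  = h (½ ℚ.* ε) (half 0<ε)
      N , close′ = h′ (½ ℚ.* ε) (half 0<ε)
  in M ℕ.⊔ N , λ n p → triangle (seq x n) (seq y n) (seq z n)
       (close n (ℕₚ.m⊔n≤o⇒m≤o M N p)) (close′ n (ℕₚ.m⊔n≤o⇒n≤o M N p))

≈-isEquivalence : IsEquivalence _≈_
≈-isEquivalence = record { refl = ≈-refl ; sym = ≈-sym ; trans = ≈-trans }

opaque
  unfolding _+_ -_ _*_

  +-congʳ : x ≈ y → x + z ≈ y + z
  +-congʳ {x} {y} {z} (mk≈ h) = mk≈ λ ε 0<ε → let N , close = h ε 0<ε in
    N , λ n N≤n → subst (λ p → ℚ.∣ p ∣ ℚ.< ε)
      (sym (cancel (seq x n) (seq y n) (seq z n))) (close n N≤n)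
    where
    open +-*-Solver
    cancel : ∀ p q r → (p ℚ.+ r) ℚ.- (q ℚ.+ r) ≡ p ℚ.- q
    cancel = solve 3 (λ p q r → (p :+ r) :- (q :+ r) := p :- q) refl

  +-comm : ∀ x y → x + y ≈ y + x
  +-comm x y = pointwise⇒≈ λ n → ℚₚ.+-comm (seq x n) (seq y n)

  -‿cong : x ≈ y → - x ≈ - y
  -‿cong {x} {y} (mk≈ h) = mk≈ λ ε 0<ε → let N , close = h ε 0<ε in
    N , λ n N≤n → subst (ℚ._< ε)
      (trans (sym (ℚₚ.∣-p∣≡∣p∣ (seq x n ℚ.- seq y n)))
             (cong ℚ.∣_∣ (ℚₚ.neg-distrib-+ (seq x n) (ℚ.- seq y n))))
      (close n N≤n)

  -- From some index on `z` is bounded by a rational `B`, so it suffices that `x` and `y` come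
  -- within ε / `B` of each other.
  *-congʳ : x ≈ y → x * z ≈ y * z
  *-congʳ {x} {y} {z} (mk≈ h) = mk≈ λ ε 0<ε →
    let B , 0<B , M , bound = eventually-bounded (seq z) (cauchy z)
        δ , 0<δ , B*δ≡ε     = quotient 0<ε 0<B
        N , close           = h δ 0<δ
    in M ℕ.⊔ N , λ n p → subst₂ ℚ._<_
         (cong ℚ.∣_∣ (factor (seq x n) (seq y n) (seq z n))) B*δ≡ε
         (product-bound (seq z n) (seq x n ℚ.- seq y n) 0<δ
           (bound n (ℕₚ.m⊔n≤o⇒m≤o M N p)) (close n (ℕₚ.m⊔n≤o⇒n≤o M N p)))
    where
    open +-*-Solver
    factor : ∀ p q r → r ℚ.* (p ℚ.- q) ≡ p ℚ.* r ℚ.- q ℚ.* r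
    factor = solve 3 (λ p q r → r :* (p :- q) := p :* r :- q :* r) refl

  *-comm : ∀ x y → x * y ≈ y * x
  *-comm x y = pointwise⇒≈ λ n → ℚₚ.*-comm (seq x n) (seq y n)

  +-assoc : ∀ x y z → (x + y) + z ≈ x + (y + z)
  +-assoc x y z = pointwise⇒≈ λ n → ℚₚ.+-assoc (seq x n) (seq y n) (seq z n)

  +-identityˡ : ∀ x → 0ℝ + x ≈ x
  +-identityˡ x = pointwise⇒≈ λ n → ℚₚ.+-identityˡ (seq x n)

  +-inverseˡ : ∀ x → - x + x ≈ 0ℝ
  +-inverseˡ x = pointwise⇒≈ λ n → ℚₚ.+-inverseˡ (seq x n)

  *-assoc : ∀ x y z → (x * y) * z ≈ x * (y * z)
  *-assoc x y z = pointwise⇒≈ λ n → ℚₚ.*-assoc (seq x n) (seq y n) (seq z n)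

  *-identityˡ : ∀ x → 1ℝ * x ≈ x
  *-identityˡ x = pointwise⇒≈ λ n → ℚₚ.*-identityˡ (seq x n)

  *-distribʳ-+ : ∀ z x y → (x + y) * z ≈ x * z + y * z
  *-distribʳ-+ z x y = pointwise⇒≈ λ n → ℚₚ.*-distribʳ-+ (seq z n) (seq x n) (seq y n)

  fromℚ-homo-+ : ∀ p q → fromℚ (p ℚ.+ q) ≈ fromℚ p + fromℚ q
  fromℚ-homo-+ p q = pointwise⇒≈ λ _ → refl

  fromℚ-homo-* : ∀ p q → fromℚ (p ℚ.* q) ≈ fromℚ p * fromℚ q
  fromℚ-homo-* p q = pointwise⇒≈ λ _ → refl

  fromℚ-homo‿- : ∀ p → fromℚ (ℚ.- p) ≈ - fromℚ p
  fromℚ-homo‿- p = pointwise⇒≈ λ _ → refl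

+-cong : x ≈ x′ → y ≈ y′ → x + y ≈ x′ + y′
+-cong {x} {x′} {y} {y′} x≈x′ y≈y′ =
  ≈-trans (+-congʳ x≈x′) (≈-trans (+-comm x′ y) (≈-trans (+-congʳ y≈y′) (+-comm y′ x′)))

*-cong : x ≈ x′ → y ≈ y′ → x * y ≈ x′ * y′
*-cong {x} {x′} {y} {y′} x≈x′ y≈y′ =
  ≈-trans (*-congʳ x≈x′) (≈-trans (*-comm x′ y) (≈-trans (*-congʳ y≈y′) (*-comm y′ x′)))

setoid : Setoid 0ℓ 0ℓ
setoid = record { isEquivalence = ≈-isEquivalence }

open import Algebra.Consequences.Setoid setoid
  using (comm∧idˡ⇒id; comm∧invˡ⇒inv; comm∧distrʳ⇒distr)

+-*-commutativeRing : CommutativeRing 0ℓ 0ℓ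
+-*-commutativeRing = record
  { Carrier = ℝ ; _≈_ = _≈_ ; _+_ = _+_ ; _*_ = _*_ ; -_ = -_ ; 0# = 0ℝ ; 1# = 1ℝ
  ; isCommutativeRing = record
    { isRing = record
      { +-isAbelianGroup = record
        { isGroup = record
          { isMonoid = record
            { isSemigroup = record
              { isMagma = record { isEquivalence = ≈-isEquivalence ; ∙-cong = +-cong }
              ; assoc = +-assoc
              }
            ; identity = comm∧idˡ⇒id +-comm +-identityˡ
            }
          ; inverse = comm∧invˡ⇒inv +-comm +-inverseˡ
          ; ⁻¹-cong = -‿cong
          }
        ; comm = +-comm
        }
      ; *-cong = *-cong
      ; *-assoc = *-assoc
      ; *-identity = comm∧idˡ⇒id *-comm *-identityˡ
      ; distrib = comm∧distrʳ⇒distr +-cong *-comm *-distribʳ-+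
      }
    ; *-comm = *-comm
    }
  }

-- Equality of reals cannot be decided, so the ring solver takes its coefficients from ℚ, where it
-- can.
fromℚ-homomorphism :
  ℚₚ.+-*-rawRing -Raw-AlmostCommutative⟶ fromCommutativeRing +-*-commutativeRing
fromℚ-homomorphism = record
  { ⟦_⟧    = fromℚ
  ; +-homo = fromℚ-homo-+
  ; *-homo = fromℚ-homo-*
  ; -‿homo = fromℚ-homo‿-
  ; 0-homo = ≈-refl
  ; 1-homo = ≈-refl
  }

fromℚ-≟ : WeaklyDecidable (Induced-equivalence fromℚ-homomorphism)
fromℚ-≟ p q = Maybe.map (λ { refl → ≈-refl }) (dec⇒maybe (p ℚₚ.≟ q))

module ℝ-Solver = RingSolver ℚₚ.+-*-rawRing
  (fromCommutativeRing +-*-commutativeRing) fromℚ-homomorphism fromℚ-≟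

-- The order of the real numbers

ℚ-<⇒≱ : ∀ {p q} → p ℚ.< q → ¬ (q ℚ.≤ p)
ℚ-<⇒≱ p<q q≤p = ℚₚ.<-irrefl refl (ℚₚ.<-≤-trans p<q q≤p)

cancel-+ : ∀ p {q r} → p ℚ.+ q ℚ.≤ p ℚ.+ r → q ℚ.≤ r
cancel-+ p {q} {r} h =
  subst₂ ℚ._≤_ (cancel p q) (cancel p r) (ℚₚ.+-monoʳ-≤ (ℚ.- p) h)
  where
  open +-*-Solver
  cancel : ∀ p q → ℚ.- p ℚ.+ (p ℚ.+ q) ≡ q
  cancel = solve 2 (λ p q → :- p :+ (p :+ q) := q) refl

-- Half of the gap absorbs the eventual distance between the two sequences; the other half remains
-- as the new gap.
0<-resp-≈ : x ≈ y → 0ℝ < x → 0ℝ < y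
0<-resp-≈ {x} {y} (mk≈ h) (mk< g 0<g M sep) =
  let N , close = h (½ ℚ.* g) (half 0<g) in
  mk< (½ ℚ.* g) (half 0<g) (M ℕ.⊔ N) λ n p → cancel-+ (½ ℚ.* g) (begin
    ½ ℚ.* g ℚ.+ (0ℚ ℚ.+ ½ ℚ.* g)  ≡⟨ regroup g ⟩
    0ℚ ℚ.+ g                      ≤⟨ sep n (ℕₚ.m⊔n≤o⇒m≤o M N p) ⟩
    seq x n                       <⟨ ∣p-q∣<ε⇒p<q+ε (seq x n) (seq y n)
                                       (close n (ℕₚ.m⊔n≤o⇒n≤o M N p)) ⟩
    seq y n ℚ.+ ½ ℚ.* g           ≡⟨ ℚₚ.+-comm (seq y n) (½ ℚ.* g) ⟩
    ½ ℚ.* g ℚ.+ seq y n           ∎)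
  where
  open ℚₚ.≤-Reasoning
  open +-*-Solver
  regroup : ∀ g → ½ ℚ.* g ℚ.+ (0ℚ ℚ.+ ½ ℚ.* g) ≡ 0ℚ ℚ.+ g
  regroup = solve 1 (λ g → con ½ :* g :+ (con 0ℚ :+ con ½ :* g) := con 0ℚ :+ g) refl

<-irrefl : ¬ (x < x)
<-irrefl {x} (mk< g 0<g N sep) = ℚ-<⇒≱ 0<g
  (cancel-+ (seq x N)
    (subst (seq x N ℚ.+ g ℚ.≤_) (sym (ℚₚ.+-identityʳ (seq x N))) (sep N ℕₚ.≤-refl)))

opaque
  unfolding _+_ -_ _*_

  x<y⇒0<y-x : x < y → 0ℝ < y - x
  x<y⇒0<y-x {x} {y} (mk< g 0<g N sep) = mk< g 0<g N λ n N≤n →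
    cancel-+ (seq x n) (subst₂ ℚ._≤_ (left (seq x n)) (right (seq x n) (seq y n)) (sep n N≤n))
    where
    open +-*-Solver
    left : ∀ p → p ℚ.+ g ≡ p ℚ.+ (0ℚ ℚ.+ g)
    left p = cong (p ℚ.+_) (sym (ℚₚ.+-identityˡ g))
    right : ∀ p q → q ≡ p ℚ.+ (q ℚ.+ ℚ.- p)
    right = solve 2 (λ p q → q := p :+ (q :+ :- p)) refl

  0<y-x⇒x<y : 0ℝ < y - x → x < y
  0<y-x⇒x<y {y} {x} (mk< g 0<g N sep) = mk< g 0<g N λ n N≤n →
    subst₂ ℚ._≤_ (left (seq x n)) (right (seq x n) (seq y n)) (ℚₚ.+-monoʳ-≤ (seq x n) (sep n N≤n))
    where
    open +-*-Solver
    left : ∀ p → p ℚ.+ (0ℚ ℚ.+ g) ≡ p ℚ.+ g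
    left p = cong (p ℚ.+_) (ℚₚ.+-identityˡ g)
    right : ∀ p q → p ℚ.+ (q ℚ.+ ℚ.- p) ≡ q
    right = solve 2 (λ p q → p :+ (q :+ :- p) := q) refl

  0<x+y : 0ℝ < x → 0ℝ < y → 0ℝ < x + y
  0<x+y {x} {y} (mk< g 0<g M sep) (mk< h 0<h N sep′) =
    mk< (g ℚ.+ h) (ℚₚ.+-mono-< 0<g 0<h) (M ℕ.⊔ N) λ n p →
      subst (ℚ._≤ seq x n ℚ.+ seq y n) (regroup g h)
        (ℚₚ.+-mono-≤ (sep n (ℕₚ.m⊔n≤o⇒m≤o M N p)) (sep′ n (ℕₚ.m⊔n≤o⇒n≤o M N p)))
    where
    open +-*-Solver
    regroup : ∀ g h → (0ℚ ℚ.+ g) ℚ.+ (0ℚ ℚ.+ h) ≡ 0ℚ ℚ.+ (g ℚ.+ h)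
    regroup = solve 2 (λ g h → (con 0ℚ :+ g) :+ (con 0ℚ :+ h) := con 0ℚ :+ (g :+ h)) refl

  0<x*y : 0ℝ < x → 0ℝ < y → 0ℝ < x * y
  0<x*y {x} {y} (mk< g 0<g M sep) (mk< h 0<h N sep′) =
    mk< (g ℚ.* h) 0<gh (M ℕ.⊔ N) λ n p →
      let g≤x = subst (ℚ._≤ seq x n) (ℚₚ.+-identityˡ g) (sep n (ℕₚ.m⊔n≤o⇒m≤o M N p))
          h≤y = subst (ℚ._≤ seq y n) (ℚₚ.+-identityˡ h) (sep′ n (ℕₚ.m⊔n≤o⇒n≤o M N p))
          0≤y = ℚₚ.≤-trans (ℚₚ.<⇒≤ 0<h) h≤y
      in begin
        0ℚ ℚ.+ g ℚ.* h         ≡⟨ ℚₚ.+-identityˡ (g ℚ.* h) ⟩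
        g ℚ.* h                ≤⟨ ℚₚ.*-monoˡ-≤-nonNeg g {{ℚ.nonNegative (ℚₚ.<⇒≤ 0<g)}} h≤y ⟩
        g ℚ.* seq y n          ≤⟨ ℚₚ.*-monoʳ-≤-nonNeg (seq y n) {{ℚ.nonNegative 0≤y}} g≤x ⟩
        seq x n ℚ.* seq y n    ∎
    where
    open ℚₚ.≤-Reasoning
    0<gh : 0ℚ ℚ.< g ℚ.* h
    0<gh = ℚₚ.positive⁻¹ (g ℚ.* h) {{ℚₚ.pos*pos⇒pos g {{ℚ.positive 0<g}} h {{ℚ.positive 0<h}}}}

-- From index `N` on the sequence falls by less than δ below a value of at least 2δ, so δ itself is
-- a gap.
eventually-positive : ∀ x {δ} → 0ℚ ℚ.< δ → ∀ N →
  (∀ n → N ℕ.≤ n → ℚ.∣ seq x N ℚ.- seq x n ∣ ℚ.< δ) → δ ℚ.+ δ ℚ.≤ seq x N → 0ℝ < x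
eventually-positive x {δ} 0<δ N close 2δ≤x = mk< δ 0<δ N λ n N≤n → cancel-+ δ (begin
  δ ℚ.+ (0ℚ ℚ.+ δ)  ≡⟨ cong (δ ℚ.+_) (ℚₚ.+-identityˡ δ) ⟩
  δ ℚ.+ δ           ≤⟨ 2δ≤x ⟩
  seq x N           <⟨ ∣p-q∣<ε⇒p<q+ε (seq x N) (seq x n) (close n N≤n) ⟩
  seq x n ℚ.+ δ     ≡⟨ ℚₚ.+-comm (seq x n) δ ⟩
  δ ℚ.+ seq x n     ∎)
  where open ℚₚ.≤-Reasoning

opaque
  unfolding -_

  seq-neg : ∀ x n → seq (- x) n ≡ ℚ.- seq x n
  seq-neg x n = refl

-- A late term of absolute value at least ε / 2 would make `x` or `- x` positive. The terms are
-- rationals and can be compared outright, so the conclusion carries no double negation.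
≯0∧≮0⇒≈0 : ¬ (0ℝ < x) → ¬ (0ℝ < - x) → x ≈ 0ℝ
≯0∧≮0⇒≈0 {x} x≯0 x≮0 = mk≈ approx
  where
  approx : ∀ ε → 0ℚ ℚ.< ε → ∃[ N ] (∀ n → N ℕ.≤ n → ℚ.∣ seq x n ℚ.- 0ℚ ∣ ℚ.< ε)
  approx ε 0<ε with cauchy x (½ ℚ.* (½ ℚ.* ε)) (half (half 0<ε))
                  | cauchy (- x) (½ ℚ.* (½ ℚ.* ε)) (half (half 0<ε))
  ... | M , close | M′ , close′ = N , λ n N≤n →
    triangle (seq x n) (seq x N) 0ℚ (small-step n N≤n)
      (subst (ℚ._< ½ ℚ.* ε) (cong ℚ.∣_∣ (sym (ℚₚ.+-identityʳ (seq x N)))) small)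
    where
    N = M ℕ.⊔ M′
    -- A quarter of ε: its double ε / 2 is the threshold for the term at `N`, and the other ε / 2
    -- covers the later oscillation.
    δ = ½ ℚ.* (½ ℚ.* ε)
    0<δ = half (half 0<ε)
    small-step : ∀ n → N ℕ.≤ n → ℚ.∣ seq x n ℚ.- seq x N ∣ ℚ.< ½ ℚ.* ε
    small-step n N≤n = ℚₚ.<-trans
      (close n N (ℕₚ.≤-trans (ℕₚ.m≤m⊔n M M′) N≤n) (ℕₚ.m≤m⊔n M M′))
      (subst₂ ℚ._<_ (ℚₚ.+-identityʳ δ) (halves (½ ℚ.* ε)) (ℚₚ.+-monoʳ-< δ 0<δ))
    not-large : ¬ (½ ℚ.* ε ℚ.≤ seq x N)
    not-large large = x≯0 (eventually-positive x 0<δ N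
      (λ n N≤n → close N n (ℕₚ.m≤m⊔n M M′) (ℕₚ.≤-trans (ℕₚ.m≤m⊔n M M′) N≤n))
      (subst (ℚ._≤ seq x N) (sym (halves (½ ℚ.* ε))) large))
    not-small : ¬ (½ ℚ.* ε ℚ.≤ ℚ.- seq x N)
    not-small large = x≮0 (eventually-positive (- x) 0<δ N
      (λ n N≤n → close′ N n (ℕₚ.m≤n⊔m M M′) (ℕₚ.≤-trans (ℕₚ.m≤n⊔m M M′) N≤n))
      (subst₂ ℚ._≤_ (sym (halves (½ ℚ.* ε))) (sym (seq-neg x N)) large))
    small : ℚ.∣ seq x N ∣ ℚ.< ½ ℚ.* ε
    small with ℚₚ.∣p∣≡p∨∣p∣≡-p (seq x N)
    ... | inj₁ eq = subst (ℚ._< ½ ℚ.* ε) (sym eq) (ℚₚ.≰⇒> not-large)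
    ... | inj₂ eq = subst (ℚ._< ½ ℚ.* ε) (sym eq) (ℚₚ.≰⇒> not-small)

-- Reciprocals of positive real numbers

inverse : ∀ {p} → 0ℚ ℚ.< p → ∃[ q ] 0ℚ ℚ.< q × p ℚ.* q ≡ 1ℚ
inverse = quotient 0<1

-- The product of `p`, `q` and the distance of their inverses is the distance of `p` and `q`. As
-- both factors are at least `g`, inverses at distance δ or more would force `p` and `q` to be at
-- least g²δ apart.
inverse-bound : ∀ {g δ p p⁻¹ q q⁻¹} → 0ℚ ℚ.< g → g ℚ.≤ p → g ℚ.≤ q →
  p ℚ.* p⁻¹ ≡ 1ℚ → q ℚ.* q⁻¹ ≡ 1ℚ →
  ℚ.∣ p ℚ.- q ∣ ℚ.< g ℚ.* (g ℚ.* δ) → ℚ.∣ p⁻¹ ℚ.- q⁻¹ ∣ ℚ.< δ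
inverse-bound {g} {δ} {p} {p⁻¹} {q} {q⁻¹} 0<g g≤p g≤q pp⁻¹ qq⁻¹ close = ℚₚ.≰⇒> λ δ≤ →
  ℚ-<⇒≱ close (begin
    g ℚ.* (g ℚ.* δ)
      ≤⟨ ℚₚ.*-monoˡ-≤-nonNeg g {{g≥0}} (ℚₚ.*-monoˡ-≤-nonNeg g {{g≥0}} δ≤) ⟩
    g ℚ.* (g ℚ.* d)
      ≤⟨ ℚₚ.*-monoˡ-≤-nonNeg g {{g≥0}} (ℚₚ.*-monoʳ-≤-nonNeg d {{d≥0}} g≤q) ⟩
    g ℚ.* (q ℚ.* d)
      ≤⟨ ℚₚ.*-monoʳ-≤-nonNeg (q ℚ.* d) {{ℚ.nonNegative 0≤qd}} g≤p ⟩
    p ℚ.* (q ℚ.* d)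
      ≡⟨ cong₂ (λ a b → a ℚ.* (b ℚ.* d)) (ℚₚ.0≤p⇒∣p∣≡p 0≤p) (ℚₚ.0≤p⇒∣p∣≡p 0≤q) ⟨
    ℚ.∣ p ∣ ℚ.* (ℚ.∣ q ∣ ℚ.* d)
      ≡⟨ cong (ℚ.∣ p ∣ ℚ.*_) (ℚₚ.∣p*q∣≡∣p∣*∣q∣ q (p⁻¹ ℚ.- q⁻¹)) ⟨
    ℚ.∣ p ∣ ℚ.* ℚ.∣ q ℚ.* (p⁻¹ ℚ.- q⁻¹) ∣
      ≡⟨ ℚₚ.∣p*q∣≡∣p∣*∣q∣ p (q ℚ.* (p⁻¹ ℚ.- q⁻¹)) ⟨
    ℚ.∣ p ℚ.* (q ℚ.* (p⁻¹ ℚ.- q⁻¹)) ∣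
      ≡⟨ cong ℚ.∣_∣ (expand p p⁻¹ q q⁻¹) ⟩
    ℚ.∣ q ℚ.* (p ℚ.* p⁻¹) ℚ.- p ℚ.* (q ℚ.* q⁻¹) ∣
      ≡⟨ cong₂ (λ a b → ℚ.∣ q ℚ.* a ℚ.- p ℚ.* b ∣) pp⁻¹ qq⁻¹ ⟩
    ℚ.∣ q ℚ.* 1ℚ ℚ.- p ℚ.* 1ℚ ∣
      ≡⟨ cong₂ (λ a b → ℚ.∣ a ℚ.- b ∣) (ℚₚ.*-identityʳ q) (ℚₚ.*-identityʳ p) ⟩
    ℚ.∣ q ℚ.- p ∣
      ≡⟨ ∣p-q∣≡∣q-p∣ q p ⟩
    ℚ.∣ p ℚ.- q ∣ ∎)
  where
  open ℚₚ.≤-Reasoning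
  open +-*-Solver
  d = ℚ.∣ p⁻¹ ℚ.- q⁻¹ ∣
  0≤p = ℚₚ.≤-trans (ℚₚ.<⇒≤ 0<g) g≤p
  0≤q = ℚₚ.≤-trans (ℚₚ.<⇒≤ 0<g) g≤q
  g≥0 = ℚ.nonNegative (ℚₚ.<⇒≤ 0<g)
  d≥0 = ℚₚ.∣-∣-nonNeg (p⁻¹ ℚ.- q⁻¹)
  0≤qd : 0ℚ ℚ.≤ q ℚ.* d
  0≤qd = subst (ℚ._≤ q ℚ.* d) (ℚₚ.*-zeroˡ d) (ℚₚ.*-monoʳ-≤-nonNeg d {{d≥0}} 0≤q)
  expand : ∀ p p⁻¹ q q⁻¹ → p ℚ.* (q ℚ.* (p⁻¹ ℚ.- q⁻¹)) ≡ q ℚ.* (p ℚ.* p⁻¹) ℚ.- p ℚ.* (q ℚ.* q⁻¹)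
  expand = solve 4 (λ p p⁻¹ q q⁻¹ →
    p :* (q :* (p⁻¹ :- q⁻¹)) := q :* (p :* p⁻¹) :- p :* (q :* q⁻¹)) refl

opaque
  unfolding _*_

  -- The sequence is cut off below at the gap, so that every term has an inverse.
  reciprocal : 0ℝ < x → ∃[ y ] 0ℝ ≤ y × x * y ≈ 1ℝ
  reciprocal {x} (mk< g 0<g N sep) = x⁻¹ , 0≤x⁻¹ , x*x⁻¹≈1
    where
    cut : ℕ → ℚ
    cut n = seq x n ℚ.⊔ g
    inv : ∀ n → ∃[ q ] 0ℚ ℚ.< q × cut n ℚ.* q ≡ 1ℚ
    inv n = inverse (ℚₚ.<-≤-trans 0<g (ℚₚ.p≤q⊔p (seq x n) g))
    cut≡x : ∀ n → N ℕ.≤ n → cut n ≡ seq x n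
    cut≡x n N≤n = ℚₚ.p≥q⇒p⊔q≡p (subst (ℚ._≤ seq x n) (ℚₚ.+-identityˡ g) (sep n N≤n))
    scaled : ∀ {ε} → 0ℚ ℚ.< ε → 0ℚ ℚ.< g ℚ.* ε
    scaled {ε} 0<ε =
      ℚₚ.positive⁻¹ (g ℚ.* ε) {{ℚₚ.pos*pos⇒pos g {{ℚ.positive 0<g}} ε {{ℚ.positive 0<ε}}}}
    x⁻¹ : ℝ
    x⁻¹ = mkℝ (λ n → proj₁ (inv n)) λ ε 0<ε →
      let M , close = cauchy x (g ℚ.* (g ℚ.* ε)) (scaled (scaled 0<ε)) in
      N ℕ.⊔ M , λ m n p q → inverse-bound 0<g
        (ℚₚ.p≤q⊔p (seq x m) g) (ℚₚ.p≤q⊔p (seq x n) g)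
        (proj₂ (proj₂ (inv m))) (proj₂ (proj₂ (inv n)))
        (subst₂ (λ a b → ℚ.∣ a ℚ.- b ∣ ℚ.< g ℚ.* (g ℚ.* ε))
          (sym (cut≡x m (ℕₚ.m⊔n≤o⇒m≤o N M p))) (sym (cut≡x n (ℕₚ.m⊔n≤o⇒m≤o N M q)))
          (close m n (ℕₚ.m⊔n≤o⇒n≤o N M p) (ℕₚ.m⊔n≤o⇒n≤o N M q)))
    0≤x⁻¹ : 0ℝ ≤ x⁻¹
    0≤x⁻¹ (mk< h 0<h M sep′) = ℚ-<⇒≱ (ℚₚ.+-mono-< (proj₁ (proj₂ (inv M))) 0<h) (sep′ M ℕₚ.≤-refl)
    x*x⁻¹≈1 : x * x⁻¹ ≈ 1ℝ
    x*x⁻¹≈1 = mk≈ λ ε 0<ε → N , λ n N≤n → subst (λ p → ℚ.∣ p ∣ ℚ.< ε)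
      (sym (trans (cong (ℚ._- 1ℚ) (x*q≡1 n N≤n)) (ℚₚ.+-inverseʳ 1ℚ))) 0<ε
      where
      x*q≡1 : ∀ n → N ℕ.≤ n → seq x n ℚ.* proj₁ (inv n) ≡ 1ℚ
      x*q≡1 n N≤n =
        trans (cong (ℚ._* proj₁ (inv n)) (sym (cut≡x n N≤n))) (proj₂ (proj₂ (inv n)))

open import Algebra.Properties.Semiring.Mult (CommutativeRing.semiring +-*-commutativeRing)
  using (×-assoc-*; ×-congʳ; ×-homo-+) renaming (_×_ to _times_)
open import Algebra.Properties.Semiring.Sum (CommutativeRing.semiring +-*-commutativeRing)
  using (sum-cong-≋; sum-replicate)
open import Relation.Binary.Reasoning.Setoid setoid
open ℝ-Solver using (Polynomial; con; solve; _:+_; _:*_; _:-_; :-_; _:=_)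

-- Laws of the ordered field

x≤y⇒0≤y-x : x ≤ y → 0ℝ ≤ y - x
x≤y⇒0≤y-x {x} {y} x≤y y-x<0 =
  x≤y (0<y-x⇒x<y (0<-resp-≈ (flip x y) (x<y⇒0<y-x y-x<0)))
  where
  flip : ∀ x y → 0ℝ - (y - x) ≈ x - y
  flip = solve 2 (λ x y → con 0ℚ :- (y :- x) := x :- y) ≈-refl

-- The parameter `z` leaves the form of the difference free, so that a ring identity can be applied
-- in the same step.
0≤y-x⇒x≤y : z ≈ y - x → 0ℝ ≤ z → x ≤ y
0≤y-x⇒x≤y {z} {y} {x} z≈y-x 0≤z y<x =
  0≤z (0<y-x⇒x<y (0<-resp-≈ x-y≈-z (x<y⇒0<y-x y<x)))
  where
  flip : ∀ x y → x - y ≈ 0ℝ - (y - x)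
  flip = solve 2 (λ x y → x :- y := con 0ℚ :- (y :- x)) ≈-refl
  x-y≈-z : x - y ≈ 0ℝ - z
  x-y≈-z = ≈-trans (flip x y) (+-cong ≈-refl (-‿cong (≈-sym z≈y-x)))

0≤-resp-≈ : x ≈ y → 0ℝ ≤ x → 0ℝ ≤ y
0≤-resp-≈ {x} {y} x≈y = 0≤y-x⇒x≤y (≈-trans x≈y (minus-0 y))
  where
  minus-0 : ∀ y → y ≈ y - 0ℝ
  minus-0 = solve 1 (λ y → y := y :- con 0ℚ) ≈-refl

≯0⇒≈0 : 0ℝ ≤ x → ¬ (0ℝ < x) → x ≈ 0ℝ
≯0⇒≈0 {x} 0≤x x≯0 = ≯0∧≮0⇒≈0 x≯0 λ 0<-x →
  0≤x (0<y-x⇒x<y (0<-resp-≈ (≈-sym (+-identityˡ (- x))) 0<-x))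

-- Since `≤` is a negation, a contradiction is sought and the cases 0 < x and x ≈ 0 may be
-- distinguished; in both of them a negative sum would make `y` negative.
0≤x+y : 0ℝ ≤ x → 0ℝ ≤ y → 0ℝ ≤ x + y
0≤x+y {x} {y} 0≤x 0≤y x+y<0 = ¬¬0<x λ 0<x →
  0≤y (0<y-x⇒x<y (0<-resp-≈ (cancel x y) (0<x+y 0<x (x<y⇒0<y-x x+y<0))))
  where
  cancel : ∀ x y → x + (0ℝ - (x + y)) ≈ 0ℝ - y
  cancel = solve 2 (λ x y → x :+ (con 0ℚ :- (x :+ y)) := con 0ℚ :- y) ≈-refl
  ¬¬0<x : ¬ ¬ (0ℝ < x)
  ¬¬0<x ¬0<x = 0≤y (0<y-x⇒x<y (0<-resp-≈
    (+-cong ≈-refl (-‿cong (≈-trans (+-congʳ (≯0⇒≈0 0≤x ¬0<x)) (+-identityˡ y))))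
    (x<y⇒0<y-x x+y<0)))

-- If both factors are positive, so is the product; if one of them is not, it is 0 and so is the
-- product. Neither is compatible with a negative product.
0≤x*y : 0ℝ ≤ x → 0ℝ ≤ y → 0ℝ ≤ x * y
0≤x*y {x} {y} 0≤x 0≤y xy<0 = ¬¬0<x λ 0<x → ¬¬0<y λ 0<y →
  <-irrefl (0<-resp-≈ (cancel (x * y)) (0<x+y (0<x*y 0<x 0<y) (x<y⇒0<y-x xy<0)))
  where
  cancel : ∀ z → z + (0ℝ - z) ≈ 0ℝ
  cancel = solve 1 (λ z → z :+ (con 0ℚ :- z) := con 0ℚ) ≈-refl
  xy≉0 : ¬ (x * y ≈ 0ℝ)
  xy≉0 xy≈0 = <-irrefl (0<-resp-≈
    (≈-trans (+-cong ≈-refl (-‿cong xy≈0)) (solve 0 (con 0ℚ :- con 0ℚ := con 0ℚ) ≈-refl))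
    (x<y⇒0<y-x xy<0))
  ¬¬0<x : ¬ ¬ (0ℝ < x)
  ¬¬0<x h = xy≉0 (≈-trans (*-cong (≯0⇒≈0 0≤x h) ≈-refl)
    (solve 1 (λ y → con 0ℚ :* y := con 0ℚ) ≈-refl y))
  ¬¬0<y : ¬ ¬ (0ℝ < y)
  ¬¬0<y h = xy≉0 (≈-trans (*-cong ≈-refl (≯0⇒≈0 0≤y h))
    (solve 1 (λ x → x :* con 0ℚ := con 0ℚ) ≈-refl x))

≤-trans : x ≤ y → y ≤ z → x ≤ z
≤-trans {x} {y} {z} x≤y y≤z =
  0≤y-x⇒x≤y (telescope x y z) (0≤x+y (x≤y⇒0≤y-x x≤y) (x≤y⇒0≤y-x y≤z))
  where
  telescope : ∀ x y z → (y - x) + (z - y) ≈ z - x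
  telescope = solve 3 (λ x y z → (y :- x) :+ (z :- y) := z :- x) ≈-refl

<⇒≤ : x < y → x ≤ y
<⇒≤ {x} {y} x<y y<x = <-irrefl (0<-resp-≈ (cancel x y) (0<x+y (x<y⇒0<y-x x<y) (x<y⇒0<y-x y<x)))
  where
  cancel : ∀ x y → (y - x) + (x - y) ≈ 0ℝ
  cancel = solve 2 (λ x y → (y :- x) :+ (x :- y) := con 0ℚ) ≈-refl

0ℝ<1ℝ : 0ℝ < 1ℝ
0ℝ<1ℝ = mk< 1ℚ 0<1 0 λ _ _ → ℚₚ.≤-refl

<-trans : x < y → y < z → x < z
<-trans {x} {y} {z} x<y y<z = 0<y-x⇒x<y
  (0<-resp-≈ (telescope x y z) (0<x+y (x<y⇒0<y-x x<y) (x<y⇒0<y-x y<z)))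
  where
  telescope : ∀ x y z → (y - x) + (z - y) ≈ z - x
  telescope = solve 3 (λ x y z → (y :- x) :+ (z :- y) := z :- x) ≈-refl

≤-resp-≈ : x ≈ x′ → y ≈ y′ → x ≤ y → x′ ≤ y′
≤-resp-≈ x≈x′ y≈y′ x≤y = 0≤y-x⇒x≤y (+-cong y≈y′ (-‿cong x≈x′)) (x≤y⇒0≤y-x x≤y)

fromℚ-mono-< : ∀ {p q} → p ℚ.< q → fromℚ p < fromℚ q
fromℚ-mono-< {p} {q} p<q =
  mk< (q ℚ.- p) (ℚₚ.<-respˡ-≡ (ℚₚ.+-inverseʳ p) (ℚₚ.+-monoˡ-< (ℚ.- p) p<q)) 0
  λ _ _ → ℚₚ.≤-reflexive (cancel p q)
  where
  module S = +-*-Solver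
  cancel : ∀ p q → p ℚ.+ (q ℚ.- p) ≡ q
  cancel = S.solve 2 (λ p q → p S.:+ (q S.:- p) S.:= q) refl

*-monoˡ-< : 0ℝ < z → x < y → x * z < y * z
*-monoˡ-< {z} {x} {y} 0<z x<y = 0<y-x⇒x<y (0<-resp-≈ (distribute x y z) (0<x*y (x<y⇒0<y-x x<y) 0<z))
  where
  distribute : ∀ x y z → (y - x) * z ≈ y * z - x * z
  distribute = solve 3 (λ x y z → (y :- x) :* z := y :* z :- x :* z) ≈-refl

suc-times-1-positive : ∀ n → 0ℝ < suc n times 1ℝ
suc-times-1-positive zero    = 0<-resp-≈ (solve 0 (con 1ℚ := con 1ℚ :+ con 0ℚ) ≈-refl) 0ℝ<1ℝ
suc-times-1-positive (suc n) = 0<x+y 0ℝ<1ℝ (suc-times-1-positive n)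

-- Positive multiples of 1 are positive, so the field has characteristic 0. This tells the lines of
-- `axesAndMore` apart.
times-1-injective : ∀ i j → i times 1ℝ ≈ j times 1ℝ → i ≡ j
times-1-injective zero    zero    _  = refl
times-1-injective zero    (suc j) eq =
  contradiction (0<-resp-≈ (≈-sym eq) (suc-times-1-positive j)) <-irrefl
times-1-injective (suc i) zero    eq =
  contradiction (0<-resp-≈ eq (suc-times-1-positive i)) <-irrefl
times-1-injective (suc i) (suc j) eq = cong suc (times-1-injective i j
  (≈-trans (cancel (i times 1ℝ)) (≈-trans (+-cong eq ≈-refl) (≈-sym (cancel (j times 1ℝ))))))
  where
  cancel : ∀ x → x ≈ (1ℝ + x) + - 1ℝ
  cancel = solve 1 (λ x → x := (con 1ℚ :+ x) :+ :- con 1ℚ) ≈-refl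

-- Minima and cells under double negation

-- Double negation is an applicative functor, so over a finite index set the double negations can be
-- collected one after another.
¬¬-choice : {P : Fin n → Set} → (∀ i → ¬ ¬ P i) → ¬ ¬ (∀ i → P i)
¬¬-choice = Finₚ.sequence (RawMonad.rawApplicative ¬¬-Monad)

-- Comparing the head with the minimum of the tail is undecidable for reals; excluded middle is
-- available under the double negation.
∃-minimum : (f : Vector ℝ (suc n)) → ¬ ¬ (∃[ i ] ∀ j → f i ≤ f j)
∃-minimum {zero}  f ¬min = ¬min (zero , λ { zero → <-irrefl })
∃-minimum {suc n} f ¬min = ∃-minimum (f ∘ suc) λ (i , fi≤) →
  ¬¬-excluded-middle λ
    { (yes f0<fi) → ¬min (zero , λ { zero    → <-irrefl
                                   ; (suc j) → ≤-trans (<⇒≤ f0<fi) (fi≤ j) })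
    ; (no  fi≤f0) → ¬min (suc i , λ { zero    → fi≤f0
                                    ; (suc j) → fi≤ j })
    }

-- Both ends belong to the cell: the last cell has to contain the right end of the whole range, and
-- closed cells still bound differences by η.
InCell : ℝ → ℕ → ℝ → Set
InCell η k x = k times η ≤ x × x ≤ suc k times η

-- A point beyond η is moved down by one cell width; any other point lies in cell 0.
∃-cell : ∀ n → 0ℝ ≤ x → x ≤ suc n times η → ¬ ¬ (∃ λ (k : Fin (suc n)) → InCell η (toℕ k) x)
∃-cell zero 0≤x x≤η ¬cell = ¬cell (zero , 0≤x , x≤η)
∃-cell {x} {η} (suc n) 0≤x x≤ ¬cell = ¬¬-excluded-middle λ
  { (yes η<x) → ∃-cell {x - η} n (x≤y⇒0≤y-x (<⇒≤ η<x))
      (0≤y-x⇒x≤y (shift x η (suc n times η)) (x≤y⇒0≤y-x x≤))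
      λ (k , lower , upper) → ¬cell (suc k ,
        0≤y-x⇒x≤y (unshift x η (toℕ k times η)) (x≤y⇒0≤y-x lower) ,
        0≤y-x⇒x≤y (unshift′ x η (suc (toℕ k) times η)) (x≤y⇒0≤y-x upper))
  ; (no  x≤η) → ¬cell (zero , 0≤x , 0≤y-x⇒x≤y (plus-0 x η) (x≤y⇒0≤y-x x≤η))
  }
  where
  shift : ∀ x η k → (η + k) - x ≈ k - (x - η)
  shift = solve 3 (λ x η k → (η :+ k) :- x := k :- (x :- η)) ≈-refl
  unshift : ∀ x η k → (x - η) - k ≈ x - (η + k)
  unshift = solve 3 (λ x η k → (x :- η) :- k := x :- (η :+ k)) ≈-refl
  unshift′ : ∀ x η k → k - (x - η) ≈ (η + k) - x
  unshift′ = solve 3 (λ x η k → k :- (x :- η) := (η :+ k) :- x) ≈-refl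
  plus-0 : ∀ x η → η - x ≈ (η + 0ℝ) - x
  plus-0 = solve 2 (λ x η → η :- x := (η :+ con 0ℚ) :- x) ≈-refl

-- The one-sided form is what keeps a weight η nonnegative after the addition of x - y.
same-cell : ∀ k → InCell η k x → InCell η k y → 0ℝ ≤ η + (x - y)
same-cell {η} {x} {y} k (kη≤x , _) (_ , y≤kη+η) =
  0≤-resp-≈ (regroup η x y (k times η)) (0≤x+y (x≤y⇒0≤y-x kη≤x) (x≤y⇒0≤y-x y≤kη+η))
  where
  regroup : ∀ η x y k → (x - k) + ((η + k) - y) ≈ η + (x - y)
  regroup = solve 4 (λ η x y k → (x :- k) :+ ((η :+ k) :- y) := η :+ (x :- y)) ≈-refl

-- Convex combinations

Weights : Pred (Vector ℝ n) 0ℓ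
Weights c = (∀ i → 0ℝ ≤ c i) × sum c ≈ 1ℝ

sum-nonneg : {c : Vector ℝ n} → (∀ i → 0ℝ ≤ c i) → 0ℝ ≤ sum c
sum-nonneg {zero}  0≤c = <-irrefl
sum-nonneg {suc n} 0≤c = 0≤x+y (0≤c zero) (sum-nonneg (0≤c ∘ suc))

term≤sum : {c : Vector ℝ n} → (∀ i → 0ℝ ≤ c i) → ∀ i → c i ≤ sum c
term≤sum {c = c} 0≤c zero =
  0≤y-x⇒x≤y (cancel (c zero) (sum (c ∘ suc))) (sum-nonneg (0≤c ∘ suc))
  where
  cancel : ∀ x s → s ≈ (x + s) - x
  cancel = solve 2 (λ x s → s := (x :+ s) :- x) ≈-refl
term≤sum {c = c} 0≤c (suc i) =
  ≤-trans (term≤sum (0≤c ∘ suc) i) (0≤y-x⇒x≤y (cancel (c zero) (sum (c ∘ suc))) (0≤c zero))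
  where
  cancel : ∀ x s → x ≈ (x + s) - s
  cancel = solve 2 (λ x s → x := (x :+ s) :- s) ≈-refl

0≤1-weight : {c : Vector ℝ n} → Weights c → ∀ i → 0ℝ ≤ 1ℝ - c i
0≤1-weight (0≤c , Σc≈1) i =
  0≤-resp-≈ (+-cong Σc≈1 ≈-refl) (x≤y⇒0≤y-x (term≤sum 0≤c i))

infix 9 _∙_

_∙_ : Vector ℝ n → Vector ℝ n → ℝ
c ∙ v = sum (λ i → c i * v i)

sum-mix : ∀ s t (c d : Vector ℝ n) → sum (λ i → s * c i + t * d i) ≈ s * sum c + t * sum d
sum-mix {zero}  s t c d = solve 2 (λ s t → con 0ℚ := s :* con 0ℚ :+ t :* con 0ℚ) ≈-refl s t
sum-mix {suc n} s t c d =
  ≈-trans (+-cong ≈-refl (sum-mix s t (c ∘ suc) (d ∘ suc)))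
          (regroup s t (c zero) (d zero) (sum (c ∘ suc)) (sum (d ∘ suc)))
  where
  regroup : ∀ s t a b x y → (s * a + t * b) + (s * x + t * y) ≈ s * (a + x) + t * (b + y)
  regroup = solve 6 (λ s t a b x y →
    (s :* a :+ t :* b) :+ (s :* x :+ t :* y) := s :* (a :+ x) :+ t :* (b :+ y)) ≈-refl

∙-mix : ∀ s t (c d v : Vector ℝ n) → (λ i → s * c i + t * d i) ∙ v ≈ s * c ∙ v + t * d ∙ v
∙-mix s t c d v = ≈-trans
  (sum-cong-≋ λ i → distribute s t (c i) (d i) (v i))
  (sum-mix s t (λ i → c i * v i) (λ i → d i * v i))
  where
  distribute : ∀ s t a b v → (s * a + t * b) * v ≈ s * (a * v) + t * (b * v)
  distribute = solve 5 (λ s t a b v →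
    (s :* a :+ t :* b) :* v := s :* (a :* v) :+ t :* (b :* v)) ≈-refl

mix-weights : ∀ {l} {c d : Vector ℝ n} → 0ℝ ≤ 1ℝ - l → 0ℝ ≤ l → Weights c → Weights d →
              Weights (λ i → (1ℝ - l) * c i + l * d i)
mix-weights {l = l} {c} {d} 0≤1-l 0≤l (0≤c , Σc≈1) (0≤d , Σd≈1) =
  (λ i → 0≤x+y (0≤x*y 0≤1-l (0≤c i)) (0≤x*y 0≤l (0≤d i))) ,
  (begin
    sum (λ i → (1ℝ - l) * c i + l * d i)  ≈⟨ sum-mix (1ℝ - l) l c d ⟩
    (1ℝ - l) * sum c + l * sum d          ≈⟨ +-cong (*-cong ≈-refl Σc≈1) (*-cong ≈-refl Σd≈1) ⟩
    (1ℝ - l) * 1ℝ + l * 1ℝ                ≈⟨ total l ⟩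
    1ℝ                                    ∎)
  where
  total : ∀ l → (1ℝ - l) * 1ℝ + l * 1ℝ ≈ 1ℝ
  total = solve 1 (λ l → (con 1ℚ :- l) :* con 1ℚ :+ l :* con 1ℚ := con 1ℚ) ≈-refl

-- The weights sum to 1, so `t` is its own average and the whole expression is a sum of nonnegative
-- terms. The slopes 1 and -1 yield lower and upper bounds for averages.
average-affine-nonneg : ∀ s t {c v : Vector ℝ n} → Weights c →
  (∀ i → 0ℝ ≤ s * v i + t) → 0ℝ ≤ s * (c ∙ v) + t
average-affine-nonneg s t {c} {v} (0≤c , Σc≈1) 0≤ = 0≤-resp-≈ (begin
  sum (λ i → c i * (s * v i + t))        ≈⟨ sum-cong-≋ (λ i → distribute s t (c i) (v i)) ⟩
  sum (λ i → s * (c i * v i) + t * c i)  ≈⟨ sum-mix s t (λ i → c i * v i) c ⟩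
  s * (c ∙ v) + t * sum c                ≈⟨ +-cong ≈-refl t*Σc≈t ⟩
  s * (c ∙ v) + t                        ∎)
  (sum-nonneg λ i → 0≤x*y (0≤c i) (0≤ i))
  where
  t*Σc≈t : t * sum c ≈ t
  t*Σc≈t = ≈-trans (*-cong ≈-refl Σc≈1) (≈-trans (*-comm t 1ℝ) (*-identityˡ t))
  distribute : ∀ s t c v → c * (s * v + t) ≈ s * (c * v) + t * c
  distribute = solve 4 (λ s t c v → c :* (s :* v :+ t) := s :* (c :* v) :+ t :* c) ≈-refl

lower-bound : ∀ {c v : Vector ℝ n} → Weights c → (∀ i → x ≤ v i) → x ≤ c ∙ v
lower-bound {x = x} {c = c} {v} w x≤v = 0≤y-x⇒x≤y (minus x (c ∙ v))
  (average-affine-nonneg 1ℝ (- x) w λ i → 0≤-resp-≈ (≈-sym (minus x (v i))) (x≤y⇒0≤y-x (x≤v i)))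
  where
  minus : ∀ x y → 1ℝ * y + - x ≈ y - x
  minus = solve 2 (λ x y → con 1ℚ :* y :+ :- x := y :- x) ≈-refl

upper-bound : ∀ {c v : Vector ℝ n} → Weights c → (∀ i → v i ≤ x) → c ∙ v ≤ x
upper-bound {x = x} {c = c} {v} w v≤x = 0≤y-x⇒x≤y (minus x (c ∙ v))
  (average-affine-nonneg (- 1ℝ) x w λ i → 0≤-resp-≈ (≈-sym (minus x (v i))) (x≤y⇒0≤y-x (v≤x i)))
  where
  minus : ∀ x y → - 1ℝ * y + x ≈ x - y
  minus = solve 2 (λ x y → (:- con 1ℚ) :* y :+ x := x :- y) ≈-refl

-- The solution `a′` of a + (c - d) = a′ + (c′ - d′). It makes the points that `shrink` produces in
-- two different homothets coincide.
shift-by : Vector ℝ n → (c d c′ d′ : Vector ℝ n) → Vector ℝ n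
shift-by a c d c′ d′ i = a i + ((c i - d i) - (c′ i - d′ i))

sum-shift-by : ∀ (a c d c′ d′ : Vector ℝ n) →
  sum (shift-by a c d c′ d′) ≈ sum a + ((sum c - sum d) - (sum c′ - sum d′))
sum-shift-by {zero} a c d c′ d′ =
  solve 0 (con 0ℚ := con 0ℚ :+ ((con 0ℚ :- con 0ℚ) :- (con 0ℚ :- con 0ℚ))) ≈-refl
sum-shift-by {suc n} a c d c′ d′ = ≈-trans
  (+-cong ≈-refl (sum-shift-by (a ∘ suc) (c ∘ suc) (d ∘ suc) (c′ ∘ suc) (d′ ∘ suc)))
  (regroup (a zero) (c zero) (d zero) (c′ zero) (d′ zero)
    (sum (a ∘ suc)) (sum (c ∘ suc)) (sum (d ∘ suc)) (sum (c′ ∘ suc)) (sum (d′ ∘ suc)))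
  where
  regroup : ∀ a c d c′ d′ A C D C′ D′ →
    (a + ((c - d) - (c′ - d′))) + (A + ((C - D) - (C′ - D′))) ≈
    (a + A) + (((c + C) - (d + D)) - ((c′ + C′) - (d′ + D′)))
  regroup = solve 10 (λ a c d c′ d′ A C D C′ D′ →
    (a :+ ((c :- d) :- (c′ :- d′))) :+ (A :+ ((C :- D) :- (C′ :- D′))) :=
    (a :+ A) :+ (((c :+ C) :- (d :+ D)) :- ((c′ :+ C′) :- (d′ :+ D′)))) ≈-refl

∙-shift-by : ∀ (a c d c′ d′ v : Vector ℝ n) →
  shift-by a c d c′ d′ ∙ v ≈ a ∙ v + ((c ∙ v - d ∙ v) - (c′ ∙ v - d′ ∙ v))
∙-shift-by a c d c′ d′ v = ≈-trans
  (sum-cong-≋ λ i → distribute (a i) (c i) (d i) (c′ i) (d′ i) (v i))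
  (sum-shift-by (λ i → a i * v i) (λ i → c i * v i) (λ i → d i * v i)
    (λ i → c′ i * v i) (λ i → d′ i * v i))
  where
  distribute : ∀ a c d c′ d′ v →
    (a + ((c - d) - (c′ - d′))) * v ≈ a * v + ((c * v - d * v) - (c′ * v - d′ * v))
  distribute = solve 6 (λ a c d c′ d′ v →
    (a :+ ((c :- d) :- (c′ :- d′))) :* v :=
    a :* v :+ ((c :* v :- d :* v) :- (c′ :* v :- d′ :* v))) ≈-refl

-- Each difference of two weight vectors has sum 0, so the total stays 1 and only nonnegativity has
-- to be assumed.
shift-by-weights : {a c d c′ d′ : Vector ℝ n} →
  Weights a → Weights c → Weights d → Weights c′ → Weights d′ →
  (∀ i → 0ℝ ≤ shift-by a c d c′ d′ i) → Weights (shift-by a c d c′ d′)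
shift-by-weights {a = a} {c} {d} {c′} {d′}
  (_ , Σa) (_ , Σc) (_ , Σd) (_ , Σc′) (_ , Σd′) 0≤ = 0≤ , (begin
  sum (shift-by a c d c′ d′)
    ≈⟨ sum-shift-by a c d c′ d′ ⟩
  sum a + ((sum c - sum d) - (sum c′ - sum d′))
    ≈⟨ +-cong Σa (-cong (-cong Σc Σd) (-cong Σc′ Σd′)) ⟩
  1ℝ + ((1ℝ - 1ℝ) - (1ℝ - 1ℝ))
    ≈⟨ solve 0 (con 1ℚ :+ ((con 1ℚ :- con 1ℚ) :- (con 1ℚ :- con 1ℚ)) := con 1ℚ) ≈-refl ⟩
  1ℝ ∎)
  where
  -cong : x ≈ x′ → y ≈ y′ → x - y ≈ x′ - y′
  -cong p q = +-cong p (-‿cong q)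

-- Homothets of a convex hull

sum²-components : ∀ (f : Vector ℝ² n) → sum² f ≡ (sum (proj₁ ∘ f) , sum (proj₂ ∘ f))
sum²-components {zero}  f = refl
sum²-components {suc n} f = cong (f zero +²_) (sum²-components (f ∘ suc))

-- One coordinate of the contraction in `shrink`. Going from `D` towards `X` by the fraction r / s
-- moves the image under the larger homothety by r (X - D), and going from `C` to X + (C - D) moves
-- the image under the smaller one by the same amount; both start from the common point.
scalar-shrink : ∀ {r s s⁻¹ t u C D} X → s * s⁻¹ ≈ 1ℝ → r * C + t ≈ s * D + u →
  s * ((1ℝ - r * s⁻¹) * D + (r * s⁻¹) * X) + u ≈ r * (X + (C - D)) + t
scalar-shrink {r} {s} {s⁻¹} {t} {u} {C} {D} X ss⁻¹≈1 common = begin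
  s * ((1ℝ - r * s⁻¹) * D + (r * s⁻¹) * X) + u  ≈⟨ expand r s s⁻¹ u D X ⟩
  (s * D + u) + (s * s⁻¹) * (r * (X - D))       ≈⟨ +-cong (≈-sym common) (*-cong ss⁻¹≈1 ≈-refl) ⟩
  (r * C + t) + 1ℝ * (r * (X - D))              ≈⟨ collect r t C D X ⟩
  r * (X + (C - D)) + t                         ∎
  where
  expand : ∀ r s s⁻¹ u D X → s * ((1ℝ - r * s⁻¹) * D + (r * s⁻¹) * X) + u ≈
                             (s * D + u) + (s * s⁻¹) * (r * (X - D))
  expand = solve 6 (λ r s s⁻¹ u D X →
    s :* ((con 1ℚ :- r :* s⁻¹) :* D :+ (r :* s⁻¹) :* X) :+ u :=
    (s :* D :+ u) :+ (s :* s⁻¹) :* (r :* (X :- D))) ≈-refl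
  collect : ∀ r t C D X → (r * C + t) + 1ℝ * (r * (X - D)) ≈ r * (X + (C - D)) + t
  collect = solve 5 (λ r t C D X →
    (r :* C :+ t) :+ con 1ℚ :* (r :* (X :- D)) := r :* (X :+ (C :- D)) :+ t) ≈-refl

-- Indexing the coordinates lets one scalar argument serve for both.
coord : Fin 2 → ℝ² → ℝ
coord zero    = proj₁
coord (suc _) = proj₂

module _ {m} (v : Vector ℝ² m) where

  open Homothety using (ratio; translation; ratio>0)

  combination : Vector ℝ m → Fin 2 → ℝ
  combination c i = c ∙ (coord i ∘ v)

  pointOf : Homothety → Vector ℝ m → Fin 2 → ℝ
  pointOf H c i = ratio H * combination c i + coord i (translation H)

  pointOf-∈ : ∀ H {c} → Weights c →
    (pointOf H c zero , pointOf H c (suc zero)) ∈ image H (convexHull v)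
  pointOf-∈ H {c} (0≤c , Σc≈1) =
    (combination c zero , combination c (suc zero)) ,
    (c , 0≤c , Σc≈1 , subst ((combination c zero , combination c (suc zero)) ≈²_)
      (sym (sum²-components (λ i → c i · v i))) (≈-refl , ≈-refl)) ,
    ≈-refl , ≈-refl

  ∈⇒pointOf : ∀ H {x} → x ∈ image H (convexHull v) →
    ∃[ c ] Weights c × (∀ i → coord i x ≈ pointOf H c i)
  ∈⇒pointOf H {x} (p , (c , 0≤c , Σc≈1 , p≈) , x≈) with sum²-components (λ i → c i · v i)
  ... | eq = c , (0≤c , Σc≈1) , λ
    { zero       → ≈-trans (proj₁ x≈) (+-cong (*-cong ≈-refl
                     (subst (λ q → proj₁ p ≈ proj₁ q) eq (proj₁ p≈))) ≈-refl)
    ; (suc zero) → ≈-trans (proj₂ x≈) (+-cong (*-cong ≈-refl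
                     (subst (λ q → proj₂ p ≈ proj₂ q) eq (proj₂ p≈))) ≈-refl)
    }

  -- Together with `common⇒≬` this replaces points of the plane by weights on the corners, to which
  -- the pigeonhole principle applies.
  ≬⇒common : ∀ A B → image A (convexHull v) ≬ image B (convexHull v) →
    ∃₂ λ c d → Weights c × Weights d × (∀ i → pointOf A c i ≈ pointOf B d i)
  ≬⇒common A B (x , x∈A , x∈B) with ∈⇒pointOf A x∈A | ∈⇒pointOf B x∈B
  ... | c , wc , x≈c | d , wd , x≈d = c , d , wc , wd , λ i → ≈-trans (≈-sym (x≈c i)) (x≈d i)

  common⇒≬ : ∀ A B {c d} → Weights c → Weights d → (∀ i → pointOf A c i ≈ pointOf B d i) →
    image A (convexHull v) ≬ image B (convexHull v)
  common⇒≬ A B {c} {d} wc wd eq with pointOf-∈ A wc | pointOf-∈ B wd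
  ... | A∋ | p , p∈ , e₁ , e₂ = _ , A∋ , p , p∈ , ≈-trans (eq zero) e₁ , ≈-trans (eq (suc zero)) e₂

  -- The homothety with ratio ratio A / ratio B centred at the common point of A and B
  -- maps B onto a translate of A, which is contained in B.
  shrink : ∀ A B {c d a} → ratio A ≤ ratio B → Weights d → Weights a →
    (∀ i → pointOf A c i ≈ pointOf B d i) →
    ∃[ b ] Weights b × (∀ i → pointOf B b i ≈
      ratio A * (combination a i + (combination c i - combination d i)) + coord i (translation A))
  shrink A B {c} {d} {a} r≤s wd wa common with reciprocal (ratio>0 B)
  ... | s⁻¹ , 0≤s⁻¹ , ss⁻¹≈1 =
    (λ i → (1ℝ - l) * d i + l * a i) ,
    mix-weights 0≤1-l (0≤x*y (<⇒≤ (ratio>0 A)) 0≤s⁻¹) wd wa ,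
    λ i → ≈-trans
      (+-cong (*-cong ≈-refl (∙-mix (1ℝ - l) l d a (coord i ∘ v))) ≈-refl)
      (scalar-shrink (combination a i) ss⁻¹≈1 (common i))
    where
    -- The ratio of the contraction; it is at most 1 because `A` is the smaller homothet.
    l = ratio A * s⁻¹
    factor : ∀ r s s⁻¹ → (s - r) * s⁻¹ ≈ s * s⁻¹ - r * s⁻¹
    factor = solve 3 (λ r s s⁻¹ → (s :- r) :* s⁻¹ := s :* s⁻¹ :- r :* s⁻¹) ≈-refl
    0≤1-l : 0ℝ ≤ 1ℝ - l
    0≤1-l = 0≤-resp-≈
      (≈-trans (factor (ratio A) (ratio B) s⁻¹) (+-cong ss⁻¹≈1 ≈-refl))
      (0≤x*y (x≤y⇒0≤y-x r≤s) 0≤s⁻¹)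

-- The pigeonhole argument

uniform : ∀ m → ∃[ η ] Weights {suc m} (λ _ → η)
-- The common entry is 1 / (m + 1), the reciprocal of the (m + 1)-fold multiple of 1.
uniform m with reciprocal (suc-times-1-positive m)
... | η , 0≤η , mη≈1 = η , (λ _ → 0≤η) , (begin
  sum {suc m} (λ _ → η)   ≈⟨ sum-replicate (suc m) ⟩
  suc m times η           ≈⟨ ×-congʳ (suc m) (≈-sym (*-identityˡ η)) ⟩
  suc m times (1ℝ * η)    ≈⟨ ×-assoc-* (suc m) 1ℝ η ⟨
  suc m times 1ℝ * η      ≈⟨ mη≈1 ⟩
  1ℝ ∎)

-- The bound (m + m) ^ m counts the ways to put m differences of weights, each in [-1, 1],
-- into m + m cells of width 1 / m.
module _ {m-1} (v : Vector ℝ² (suc m-1)) where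

  private
    m = suc m-1

  open Homothety using (ratio; translation)

  meeting-smallest⇒≬ : ∀ {N} (A : Homothety) (B : Fin N → Homothety) → (m ℕ.+ m) ^ m ℕ.< N →
    (∀ j → ratio A ≤ ratio (B j)) →
    (∀ j → image A (convexHull v) ≬ image (B j) (convexHull v)) →
    ¬ ¬ (∃₂ λ j k → j ≢ k × image (B j) (convexHull v) ≬ image (B k) (convexHull v))
  meeting-smallest⇒≬ {N} A B big smallest meets ¬pair =
    -- The goal is a contradiction, so a cell may be chosen for each of the finitely many entries.
    ¬¬-choice (λ j → ¬¬-choice (cell j)) λ cells →
      let
        -- The whole table of m cell numbers belonging to an index is coded as one number below (m +
        -- m) ^ m, so equal codes mean equal cells in every entry.
        j , k , j<k , same = Finₚ.pigeonhole big λ j → funToFin λ i → proj₁ (cells j i)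
        same-index : ∀ i → proj₁ (cells j i) ≡ proj₁ (cells k i)
        same-index i = trans (sym (Finₚ.finToFun-funToFin (λ i → proj₁ (cells j i)) i))
          (trans (cong (λ f → finToFun f i) same)
            (Finₚ.finToFun-funToFin (λ i → proj₁ (cells k i)) i))
        -- Within one cell the two differences are at most ω = 1 / m apart, so the shift cannot push
        -- the uniform weight ω below 0.
        0≤a : ∀ i → 0ℝ ≤ shift-by (λ _ → ω) (c j) (d j) (c k) (d k) i
        0≤a i = 0≤-resp-≈ (remove-1 ω (c j i) (d j i) (c k i) (d k i))
          (same-cell (toℕ (proj₁ (cells j i))) (proj₂ (cells j i))
            (subst (λ p → InCell ω (toℕ p) (diff k i)) (sym (same-index i)) (proj₂ (cells k i))))
        -- The uniform weights go into the translate of `A` inside `B j`, the shifted ones into the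
        -- translate inside `B k`; the shift makes the two points equal.
        b , wb , b≈ = shrink v A (B j) {c = c j} (smallest j) (wd j) wω (common j)
        b′ , wb′ , b′≈ = shrink v A (B k) {c = c k} (smallest k) (wd k)
          (shift-by-weights wω (wc j) (wd j) (wc k) (wd k) 0≤a) (common k)
      in ¬pair (j , k , Finₚ.<⇒≢ j<k , common⇒≬ v (B j) (B k) wb wb′ λ i → begin
        pointOf v (B j) b i
          ≈⟨ b≈ i ⟩
        ratio A * (combination v (λ _ → ω) i + (combination v (c j) i - combination v (d j) i)) +
          coord i (translation A)
          ≈⟨ +-cong (*-cong ≈-refl (≈-trans
               (regroup (combination v (λ _ → ω) i) (combination v (c j) i) (combination v (d j) i)
                 (combination v (c k) i) (combination v (d k) i))
               (+-cong (≈-sym (∙-shift-by (λ _ → ω) (c j) (d j) (c k) (d k) (coord i ∘ v)))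
                       ≈-refl))) ≈-refl ⟩
        ratio A * (combination v (shift-by (λ _ → ω) (c j) (d j) (c k) (d k)) i +
                   (combination v (c k) i - combination v (d k) i)) +
          coord i (translation A)
          ≈⟨ b′≈ i ⟨
        pointOf v (B k) b′ i ∎)
    where
    ω = proj₁ (uniform m-1)
    wω : Weights {m} (λ _ → ω)
    wω = proj₂ (uniform m-1)
    commonWeights : ∀ j → _
    commonWeights j = ≬⇒common v A (B j) (meets j)
    c d : Fin N → Vector ℝ m
    c j = proj₁ (commonWeights j)
    d j = proj₁ (proj₂ (commonWeights j))
    wc : ∀ j → Weights (c j)
    wc j = proj₁ (proj₂ (proj₂ (commonWeights j)))
    wd : ∀ j → Weights (d j)
    wd j = proj₁ (proj₂ (proj₂ (proj₂ (commonWeights j))))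
    common : ∀ j i → pointOf v A (c j) i ≈ pointOf v (B j) (d j) i
    common j = proj₂ (proj₂ (proj₂ (proj₂ (commonWeights j))))
    -- The entry of c - d, raised by 1 so that it lies in [0, 2] and cells can be numbered from 0.
    diff : Fin N → Fin m → ℝ
    diff j i = c j i + (1ℝ - d j i)
    mω≈1 : m times ω ≈ 1ℝ
    mω≈1 = ≈-trans (≈-sym (sum-replicate m)) (proj₂ wω)
    cell : ∀ j i → ¬ ¬ (∃ λ (k : Fin (m ℕ.+ m)) → InCell ω (toℕ k) (diff j i))
    -- The successor of this argument is m + m, the number of cells of width 1 / m that cover
    -- [0, 2].
    cell j i = ∃-cell (m-1 ℕ.+ m) (0≤x+y (proj₁ (wc j) i) (0≤1-weight (wd j) i))
      (0≤y-x⇒x≤y (≈-trans (two (c j i) (d j i)) (+-cong 2≈2mω ≈-refl))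
        (0≤x+y (0≤1-weight (wc j) i) (proj₁ (wd j) i)))
      where
      two : ∀ c d → (1ℝ - c) + d ≈ (1ℝ + 1ℝ) - (c + (1ℝ - d))
      two = solve 2 (λ c d →
        (con 1ℚ :- c) :+ d := (con 1ℚ :+ con 1ℚ) :- (c :+ (con 1ℚ :- d))) ≈-refl
      2≈2mω : 1ℝ + 1ℝ ≈ (m ℕ.+ m) times ω
      2≈2mω = ≈-sym (≈-trans (×-homo-+ ω m m) (+-cong mω≈1 mω≈1))
    remove-1 : ∀ ω c d c′ d′ → ω + ((c + (1ℝ - d)) - (c′ + (1ℝ - d′))) ≈ ω + ((c - d) - (c′ - d′))
    remove-1 = solve 5 (λ ω c d c′ d′ → ω :+ ((c :+ (con 1ℚ :- d)) :- (c′ :+ (con 1ℚ :- d′))) :=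
      ω :+ ((c :- d) :- (c′ :- d′))) ≈-refl
    regroup : ∀ a C D C′ D′ → a + (C - D) ≈ (a + ((C - D) - (C′ - D′))) + (C′ - D′)
    regroup = solve 5 (λ a C D C′ D′ →
      a :+ (C :- D) := (a :+ ((C :- D) :- (C′ :- D′))) :+ (C′ :- D′)) ≈-refl

-- Crossing strips

module Rectangle {x₀ x₁ y₀ y₁ : ℝ} (x₀<x₁ : x₀ < x₁) (y₀<y₁ : y₀ < y₁) where

  corner : Vector ℝ² 4
  corner zero                   = x₀ , y₀
  corner (suc zero)             = x₁ , y₀
  corner (suc (suc zero))       = x₁ , y₁
  corner (suc (suc (suc zero))) = x₀ , y₁

  rectangle : Polygon
  rectangle = record { size-3 = 1 ; vertex = corner ; convex = convex }
    where
    -- Any three corners in counterclockwise order span half of the rectangle, so each of the eight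
    -- orientations equals its full area.
    Area : ℝ² → ℝ² → ℝ² → Set
    Area a b c = (x₁ - x₀) * (y₁ - y₀) ≈ orient a b c
    area : ∀ {a b c} → Area a b c → 0ℝ < orient a b c
    area eq = 0<-resp-≈ eq (0<x*y (x<y⇒0<y-x x₀<x₁) (x<y⇒0<y-x y₀<y₁))
    Point = Polynomial 4 × Polynomial 4
    -- A copy of `orient` in the syntax of the ring solver.
    orientation : Point → Point → Point → Polynomial 4
    orientation (a , b) (c , d) (e , f) = (c :- a) :* (f :- b) :- (d :- b) :* (e :- a)
    convex : ∀ i j → j ≢ i → j ≢ next i → 0ℝ < orient (corner i) (corner (next i)) (corner j)
    convex zero zero j≢i _ = contradiction refl j≢i
    convex zero (suc zero) _ j≢ni = contradiction refl j≢ni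
    convex zero (suc (suc zero)) _ _ = area (solve 4 (λ a b c d →
      (b :- a) :* (d :- c) := orientation (a , c) (b , c) (b , d)) ≈-refl x₀ x₁ y₀ y₁)
    convex zero (suc (suc (suc zero))) _ _ = area (solve 4 (λ a b c d →
      (b :- a) :* (d :- c) := orientation (a , c) (b , c) (a , d)) ≈-refl x₀ x₁ y₀ y₁)
    convex (suc zero) zero _ _ = area (solve 4 (λ a b c d →
      (b :- a) :* (d :- c) := orientation (b , c) (b , d) (a , c)) ≈-refl x₀ x₁ y₀ y₁)
    convex (suc zero) (suc zero) j≢i _ = contradiction refl j≢i
    convex (suc zero) (suc (suc zero)) _ j≢ni = contradiction refl j≢ni
    convex (suc zero) (suc (suc (suc zero))) _ _ = area (solve 4 (λ a b c d →
      (b :- a) :* (d :- c) := orientation (b , c) (b , d) (a , d)) ≈-refl x₀ x₁ y₀ y₁)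
    convex (suc (suc zero)) zero _ _ = area (solve 4 (λ a b c d →
      (b :- a) :* (d :- c) := orientation (b , d) (a , d) (a , c)) ≈-refl x₀ x₁ y₀ y₁)
    convex (suc (suc zero)) (suc zero) _ _ = area (solve 4 (λ a b c d →
      (b :- a) :* (d :- c) := orientation (b , d) (a , d) (b , c)) ≈-refl x₀ x₁ y₀ y₁)
    convex (suc (suc zero)) (suc (suc zero)) j≢i _ = contradiction refl j≢i
    convex (suc (suc zero)) (suc (suc (suc zero))) _ j≢ni = contradiction refl j≢ni
    convex (suc (suc (suc zero))) zero _ j≢ni = contradiction refl j≢ni
    convex (suc (suc (suc zero))) (suc zero) _ _ = area (solve 4 (λ a b c d →
      (b :- a) :* (d :- c) := orientation (a , d) (a , c) (b , c)) ≈-refl x₀ x₁ y₀ y₁)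
    convex (suc (suc (suc zero))) (suc (suc zero)) _ _ = area (solve 4 (λ a b c d →
      (b :- a) :* (d :- c) := orientation (a , d) (a , c) (b , d)) ≈-refl x₀ x₁ y₀ y₁)
    convex (suc (suc (suc zero))) (suc (suc (suc zero))) j≢i _ = contradiction refl j≢i

  rectangle-∋ : ∀ {s t p} → 0ℝ ≤ s → 0ℝ ≤ 1ℝ - s → 0ℝ ≤ t → 0ℝ ≤ 1ℝ - t →
    p ≈² (x₀ + s * (x₁ - x₀) , y₀ + t * (y₁ - y₀)) → p ∈ region rectangle
  rectangle-∋ {s} {t} 0≤s 0≤1-s 0≤t 0≤1-t (p₁≈ , p₂≈) = c , 0≤c , total s t ,
    (≈-trans p₁≈ (abscissa s t x₀ x₁) , ≈-trans p₂≈ (ordinate s t y₀ y₁))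
    where
    -- Bilinear weights: each corner receives the product of its weights along the two axes.
    c : Vector ℝ 4
    c zero                   = (1ℝ - s) * (1ℝ - t)
    c (suc zero)             = s * (1ℝ - t)
    c (suc (suc zero))       = s * t
    c (suc (suc (suc zero))) = (1ℝ - s) * t
    0≤c : ∀ i → 0ℝ ≤ c i
    0≤c zero                   = 0≤x*y 0≤1-s 0≤1-t
    0≤c (suc zero)             = 0≤x*y 0≤s 0≤1-t
    0≤c (suc (suc zero))       = 0≤x*y 0≤s 0≤t
    0≤c (suc (suc (suc zero))) = 0≤x*y 0≤1-s 0≤t
    total : ∀ s t → (1ℝ - s) * (1ℝ - t) + (s * (1ℝ - t) + (s * t + ((1ℝ - s) * t + 0ℝ))) ≈ 1ℝ
    total = solve 2 (λ s t → (con 1ℚ :- s) :* (con 1ℚ :- t) :+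
      (s :* (con 1ℚ :- t) :+ (s :* t :+ ((con 1ℚ :- s) :* t :+ con 0ℚ))) := con 1ℚ) ≈-refl
    abscissa : ∀ s t x₀ x₁ → x₀ + s * (x₁ - x₀) ≈ (1ℝ - s) * (1ℝ - t) * x₀ +
      (s * (1ℝ - t) * x₁ + (s * t * x₁ + ((1ℝ - s) * t * x₀ + 0ℝ)))
    abscissa = solve 4 (λ s t x₀ x₁ → x₀ :+ s :* (x₁ :- x₀) :=
      (con 1ℚ :- s) :* (con 1ℚ :- t) :* x₀ :+ (s :* (con 1ℚ :- t) :* x₁ :+
        (s :* t :* x₁ :+ ((con 1ℚ :- s) :* t :* x₀ :+ con 0ℚ)))) ≈-refl
    ordinate : ∀ s t y₀ y₁ → y₀ + t * (y₁ - y₀) ≈ (1ℝ - s) * (1ℝ - t) * y₀ +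
      (s * (1ℝ - t) * y₀ + (s * t * y₁ + ((1ℝ - s) * t * y₁ + 0ℝ)))
    ordinate = solve 4 (λ s t y₀ y₁ → y₀ :+ t :* (y₁ :- y₀) :=
      (con 1ℚ :- s) :* (con 1ℚ :- t) :* y₀ :+ (s :* (con 1ℚ :- t) :* y₀ :+
        (s :* t :* y₁ :+ ((con 1ℚ :- s) :* t :* y₁ :+ con 0ℚ)))) ≈-refl

  abscissa-bounds : ∀ {p} → p ∈ region rectangle → x₀ ≤ proj₁ p × proj₁ p ≤ x₁
  abscissa-bounds (c , 0≤c , Σc≈1 , p₁≈ , _) =
    ≤-resp-≈ ≈-refl (≈-sym p₁≈) (lower-bound (0≤c , Σc≈1) x₀≤) ,
    ≤-resp-≈ (≈-sym p₁≈) ≈-refl (upper-bound (0≤c , Σc≈1) ≤x₁)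
    where
    x₀≤ : ∀ i → x₀ ≤ proj₁ (corner i)
    x₀≤ zero                   = <-irrefl
    x₀≤ (suc zero)             = <⇒≤ x₀<x₁
    x₀≤ (suc (suc zero))       = <⇒≤ x₀<x₁
    x₀≤ (suc (suc (suc zero))) = <-irrefl
    ≤x₁ : ∀ i → proj₁ (corner i) ≤ x₁
    ≤x₁ zero                   = <⇒≤ x₀<x₁
    ≤x₁ (suc zero)             = <-irrefl
    ≤x₁ (suc (suc zero))       = <-irrefl
    ≤x₁ (suc (suc (suc zero))) = <⇒≤ x₀<x₁

  ordinate-bounds : ∀ {p} → p ∈ region rectangle → y₀ ≤ proj₂ p × proj₂ p ≤ y₁
  ordinate-bounds (c , 0≤c , Σc≈1 , _ , p₂≈) =
    ≤-resp-≈ ≈-refl (≈-sym p₂≈) (lower-bound (0≤c , Σc≈1) y₀≤) ,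
    ≤-resp-≈ (≈-sym p₂≈) ≈-refl (upper-bound (0≤c , Σc≈1) ≤y₁)
    where
    y₀≤ : ∀ i → y₀ ≤ proj₂ (corner i)
    y₀≤ zero                   = <-irrefl
    y₀≤ (suc zero)             = <-irrefl
    y₀≤ (suc (suc zero))       = <⇒≤ y₀<y₁
    y₀≤ (suc (suc (suc zero))) = <⇒≤ y₀<y₁
    ≤y₁ : ∀ i → proj₂ (corner i) ≤ y₁
    ≤y₁ zero                   = <⇒≤ y₀<y₁
    ≤y₁ (suc zero)             = <⇒≤ y₀<y₁
    ≤y₁ (suc (suc zero))       = <-irrefl
    ≤y₁ (suc (suc (suc zero))) = <-irrefl

-- The first two of these lines are the coordinate axes.
axesAndMore : ∀ k → LineSet k
axesAndMore k = record
  { line = λ i → record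
    -- The directions are (i, 1 - i). The cross product of (a, 1 - a) and (b, 1 - b) is a - b, so
    -- different indices give different lines.
    { direction = toℕ i times 1ℝ , 1ℝ - toℕ i times 1ℝ
    ; nonzero   = λ (a≈0 , 1-a≈0) → <-irrefl (0<-resp-≈
        (≈-trans (split (toℕ i times 1ℝ)) (≈-trans (+-cong a≈0 1-a≈0) (+-identityˡ 0ℝ))) 0ℝ<1ℝ)
    }
  ; distinct = λ {i} {j} parallel → Finₚ.toℕ-injective (times-1-injective (toℕ i) (toℕ j)
      (≈-trans (difference (toℕ i times 1ℝ) (toℕ j times 1ℝ))
        (≈-trans (+-cong parallel ≈-refl) (+-identityˡ (toℕ j times 1ℝ)))))
  }
  where
  split : ∀ a → 1ℝ ≈ a + (1ℝ - a)
  split = solve 1 (λ a → con 1ℚ := a :+ (con 1ℚ :- a)) ≈-refl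
  difference : ∀ a b → a ≈ (a * (1ℝ - b) - (1ℝ - a) * b) + b
  difference = solve 2 (λ a b → a := (a :* (con 1ℚ :- b) :- (con 1ℚ :- a) :* b) :+ b) ≈-refl

rectangle-∈-𝒫 : ∀ {k x₀ x₁ y₀ y₁} (x₀<x₁ : x₀ < x₁) (y₀<y₁ : y₀ < y₁) →
  Rectangle.rectangle x₀<x₁ y₀<y₁ ∈ 𝒫 (axesAndMore (2 ℕ.+ k))
rectangle-∈-𝒫 {x₀ = x₀} {x₁} {y₀} {y₁} _ _ = λ
  -- Index 0 is the vertical direction (0, 1), index 1 the horizontal direction (1, 0).
  { zero                   → suc zero , horizontal (x₁ - x₀) y₀
  ; (suc zero)             → zero     , vertical (y₁ - y₀) x₁
  ; (suc (suc zero))       → suc zero , horizontal (x₀ - x₁) y₁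
  ; (suc (suc (suc zero))) → zero     , vertical (y₀ - y₁) x₀
  }
  where
  horizontal : ∀ w y → w * (1ℝ - (1ℝ + 0ℝ)) - (y - y) * (1ℝ + 0ℝ) ≈ 0ℝ
  horizontal = solve 2 (λ w y →
    w :* (con 1ℚ :- (con 1ℚ :+ con 0ℚ)) :- (y :- y) :* (con 1ℚ :+ con 0ℚ) := con 0ℚ) ≈-refl
  vertical : ∀ h x → (x - x) * (1ℝ - 0ℝ) - h * 0ℝ ≈ 0ℝ
  vertical = solve 2 (λ h x → (x :- x) :* (con 1ℚ :- con 0ℚ) :- h :* con 0ℚ := con 0ℚ) ≈-refl

¼ : ℚ
¼ = ½ ℚ.* ½

¼<½ : ¼ ℚ.< ½
¼<½ = from-yes (¼ ℚₚ.<? ½)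

-- The k-th interval reaches from half of 4^(-k) to 4^(-k). These intervals are pairwise disjoint
-- and lie in (0, 1], so one sequence serves for every number of strips.
upper lower : ℕ → ℝ
upper zero    = 1ℝ
upper (suc k) = fromℚ ¼ * upper k
lower k = fromℚ ½ * upper k

0<upper : ∀ k → 0ℝ < upper k
0<upper zero    = 0ℝ<1ℝ
0<upper (suc k) = 0<x*y (fromℚ-mono-< (from-yes (0ℚ ℚₚ.<? ¼))) (0<upper k)

0<lower : ∀ k → 0ℝ < lower k
0<lower k = 0<x*y (fromℚ-mono-< (from-yes (0ℚ ℚₚ.<? ½))) (0<upper k)

scale< : ∀ {q} k → q ℚ.< 1ℚ → fromℚ q * upper k < upper k
scale< {q} k q<1 = 0<y-x⇒x<y (0<-resp-≈ (+-cong (*-identityˡ (upper k)) ≈-refl)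
  (x<y⇒0<y-x (*-monoˡ-< (0<upper k) (fromℚ-mono-< q<1))))

lower<upper : ∀ k → lower k < upper k
lower<upper k = scale< k (from-yes (½ ℚₚ.<? 1ℚ))

upper≤1 : ∀ k → upper k ≤ 1ℝ
upper≤1 zero    = <-irrefl
upper≤1 (suc k) = ≤-trans (<⇒≤ (scale< k (from-yes (¼ ℚₚ.<? 1ℚ)))) (upper≤1 k)

upper<lower : ∀ {k l} → k ℕ.< l → upper l < lower k
upper<lower {k} {suc l} k<1+l with ℕₚ.m<1+n⇒m<n∨m≡n k<1+l
... | inj₁ k<l  = <-trans (scale< l (from-yes (¼ ℚₚ.<? 1ℚ))) (upper<lower k<l)
... | inj₂ refl = *-monoˡ-< (0<upper k) (fromℚ-mono-< ¼<½)

strip : Fin 2 → ℕ → Polygon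
strip zero       k = Rectangle.rectangle 0ℝ<1ℝ (lower<upper k)
strip (suc zero) k = Rectangle.rectangle (lower<upper k) 0ℝ<1ℝ

strip-∈-𝒫 : ∀ {k} s l → strip s l ∈ 𝒫 (axesAndMore (2 ℕ.+ k))
strip-∈-𝒫 zero       l = rectangle-∈-𝒫 0ℝ<1ℝ (lower<upper l)
strip-∈-𝒫 (suc zero) l = rectangle-∈-𝒫 (lower<upper l) 0ℝ<1ℝ

-- The point is the lower left corner of the overlap of horizontal strip `k` and vertical strip `l`.
-- It lies on the bottom edge of the former and, in `vertical-∋`, on the left edge of the latter.
horizontal-∋ : ∀ k l → (lower l , lower k) ∈ region (strip zero k)
horizontal-∋ k l = Rectangle.rectangle-∋ 0ℝ<1ℝ (lower<upper k)
  (<⇒≤ (0<lower l)) (x≤y⇒0≤y-x (≤-trans (<⇒≤ (lower<upper l)) (upper≤1 l)))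
  <-irrefl (x≤y⇒0≤y-x (<⇒≤ 0ℝ<1ℝ))
  ( solve 1 (λ a → a := con 0ℚ :+ a :* (con 1ℚ :- con 0ℚ)) ≈-refl (lower l)
  , solve 2 (λ a b → a := a :+ con 0ℚ :* (b :- a)) ≈-refl (lower k) (upper k))

vertical-∋ : ∀ k l → (lower l , lower k) ∈ region (strip (suc zero) l)
vertical-∋ k l = Rectangle.rectangle-∋ (lower<upper l) 0ℝ<1ℝ
  <-irrefl (x≤y⇒0≤y-x (<⇒≤ 0ℝ<1ℝ))
  (<⇒≤ (0<lower k)) (x≤y⇒0≤y-x (≤-trans (<⇒≤ (lower<upper k)) (upper≤1 k)))
  ( solve 2 (λ a b → a := a :+ con 0ℚ :* (b :- a)) ≈-refl (lower l) (upper l)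
  , solve 1 (λ a → a := con 0ℚ :+ a :* (con 1ℚ :- con 0ℚ)) ≈-refl (lower k))

strips-cross : ∀ s s′ k l → s ≢ s′ → region (strip s k) ≬ region (strip s′ l)
strips-cross zero       zero       k l s≢s′ = contradiction refl s≢s′
strips-cross zero       (suc zero) k l _    = _ , horizontal-∋ k l , vertical-∋ k l
strips-cross (suc zero) zero       k l _    = _ , vertical-∋ l k , horizontal-∋ l k
strips-cross (suc zero) (suc zero) k l s≢s′ = contradiction refl s≢s′

parallel-strips-disjoint : ∀ s {k l} → k ℕ.< l → ¬ (region (strip s k) ≬ region (strip s l))
parallel-strips-disjoint zero {k} {l} k<l (p , p∈k , p∈l) =
  -- A common point yields `lower k ≤ upper l`, which as a negation is applied to the opposite
  -- strict inequality.
  ≤-trans (proj₁ (Rectangle.ordinate-bounds 0ℝ<1ℝ (lower<upper k) p∈k))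
          (proj₂ (Rectangle.ordinate-bounds 0ℝ<1ℝ (lower<upper l) p∈l)) (upper<lower k<l)
parallel-strips-disjoint (suc zero) {k} {l} k<l (p , p∈k , p∈l) =
  ≤-trans (proj₁ (Rectangle.abscissa-bounds (lower<upper k) 0ℝ<1ℝ p∈k))
          (proj₂ (Rectangle.abscissa-bounds (lower<upper l) 0ℝ<1ℝ p∈l)) (upper<lower k<l)

strips-≬⇒≡ : ∀ s {k l} → region (strip s k) ≬ region (strip s l) → k ≡ l
strips-≬⇒≡ s {k} {l} meet@(p , p∈k , p∈l) with ℕₚ.<-cmp k l
... | tri< k<l _ _ = contradiction meet (parallel-strips-disjoint s k<l)
... | tri≈ _ k≡l _ = k≡l
... | tri> _ _ l<k = contradiction (p , p∈l , p∈k) (parallel-strips-disjoint s l<k)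

-- The complete bipartite graph

module _ (N : ℕ) where

  -- A vertex has to be a number, so `remQuot` decodes it into a side and a position on that side.
  side : Fin (2 ℕ.* N) → Fin 2
  side u = proj₁ (remQuot {2} N u)

  index : Fin (2 ℕ.* N) → Fin N
  index u = proj₂ (remQuot {2} N u)

  completeBipartite : Graph
  completeBipartite = record
    { order       = 2 ℕ.* N
    ; Adj         = λ u v → side u ≢ side v
    ; symmetric   = λ ne eq → ne (sym eq)
    ; irreflexive = λ { refl ne → ne refl }
    }

  side-combine : ∀ s j → side (combine {2} {N} s j) ≡ s
  side-combine s j = cong proj₁ (Finₚ.remQuot-combine {2} {N} s j)

  completeBipartite-∈-DIR-CONV : ∀ k → completeBipartite ∈ ((2 ℕ.+ k) DIR-CONV)
  completeBipartite-∈-DIR-CONV k = axesAndMore (2 ℕ.+ k) ,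
    (λ u → strip (side u) (toℕ (index u))) ,
    (λ u → strip-∈-𝒫 (side u) (toℕ (index u))) ,
    λ u v u≢v → mk⇔
      (strips-cross (side u) (side v) (toℕ (index u)) (toℕ (index v)))
      (λ meet side≡ → u≢v (vertex-≡ side≡ (Finₚ.toℕ-injective (strips-≬⇒≡ (side v)
        (subst (λ s → region (strip s (toℕ (index u))) ≬
                      region (strip (side v) (toℕ (index v)))) side≡ meet)))))
    where
    vertex-≡ : ∀ {u v} → side u ≡ side v → index u ≡ index v → u ≡ v
    vertex-≡ {u} {v} side≡ index≡ = trans (sym (Finₚ.combine-remQuot {2} N u))
      (trans (cong₂ combine side≡ index≡) (Finₚ.combine-remQuot {2} N v))

other : ∀ (s : Fin 2) → ∃[ s′ ] s ≢ s′
other zero       = suc zero , λ ()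
other (suc zero) = zero , λ ()

corners : Polygon → ℕ
corners P = 3 ℕ.+ Polygon.size-3 P

-- One more than the number of cell tables for a polygon with this many corners, which is what the
-- pigeonhole principle asks for.
parts : Polygon → ℕ
parts P = suc ((corners P ℕ.+ corners P) ^ corners P)

completeBipartite-∉-hom : ∀ P → ¬ (completeBipartite (parts P) ∈ (P hom))
completeBipartite-∉-hom P (H , isIntersectionGraph) =
  -- The number of vertices reduces to a successor, so a smallest homothet exists up to double
  -- negation, and the goal is a contradiction.
  ∃-minimum (λ u → ratio (H u)) λ (u , smallest) →
    let
      s , side-u≢s = other (side N u)
      opposite = combine {2} {N} s
      side-opposite = side-combine N s
      adjacent : ∀ j → side N u ≢ side N (opposite j)
      adjacent j = subst (side N u ≢_) (sym (side-opposite j)) side-u≢s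
      neighbour : ∀ j → u ≢ opposite j
      neighbour j u≡ = adjacent j (cong (side N) u≡)
    in
    meeting-smallest⇒≬ (Polygon.vertex P) (H u) (λ j → H (opposite j)) ℕₚ.≤-refl
      (λ j → smallest (opposite j))
      (λ j → Equivalence.to (isIntersectionGraph u (opposite j) (neighbour j)) (adjacent j))
      λ (j , k , j≢k , meet) →
        -- Meeting homothets would make two vertices on the same side adjacent, whereas adjacency
        -- means that the sides differ.
        Equivalence.from
          (isIntersectionGraph (opposite j) (opposite k)
            (λ eq → j≢k (Finₚ.combine-injectiveʳ {2} {N} s j s k eq)))
          meet (trans (side-opposite j) (sym (side-opposite k)))
  where
  open Homothety using (ratio)
  N = parts P

proposition1 : (P : Polygon) (k : ℕ) → 2 ℕ.≤ k → k DIR-CONV ⊈ P hom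
proposition1 P (suc (suc k)) (s≤s (s≤s z≤n)) ⊆hom =
  completeBipartite-∉-hom P
    (⊆hom {completeBipartite (parts P)} (completeBipartite-∈-DIR-CONV (parts P) k))
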